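{- Suppose $p\nmid g(T_1,0)$, i.e. $g(T_1,0)\not\equiv0\pmod p$. Assume that for every finite order character $\psi$ of $\Gamma$ there is an inclusion of ideals $\big(L(T_1,\psi(T_2))\big)\subseteq\big(g(T_1,\psi(T_2))\big)$ in $\mathcal O_\psi[[T_1]]$. Then $\big(L(T_1,T_2)\big)\subseteq\big(g(T_1,T_2)\big)$ in $\mathbb Z_p[[T_1,T_2]]$.
   Context: Let $p$ be an odd prime, $E/\mathbb Q$ an elliptic curve of conductor $N$ with associated newform $f\in S_2(\Gamma_0(N))$, assumed $p$-ordinary, $k$ an imaginary quadratic field, $k_\infty$ the compositum of all $\mathbb Z_p$-extensions of $k$, $G=\mathrm{Gal}(k_\infty/k)\cong\mathbb Z_p^2$, $k^{\mathrm{cyc}}$ and $D_\infty$ the cyclotomic and anticyclotomic $\mathbb Z_p$-extensions, $\Gamma=\mathrm{Gal}(k^{\mathrm{cyc}}/k)$, $\Omega=\mathrm{Gal}(D_\infty/k)$, $H=\mathrm{Gal}(k_\infty/k^{\mathrm{cyc}})$ (which maps isomorphically onto $\Omega$), so that $G=H\times\mathrm{Gal}(k_\infty/D_\infty)$ with $\mathrm{Gal}(k_\infty/D_\infty)$ mapping isomorphically onto $\Gamma$. Fix topological generators $\gamma_1$ of $H$ and $\gamma_2$ of $\mathrm{Gal}(k_\infty/D_\infty)$, and the isomorphism $\Lambda(G)=\mathbb Z_p[[G]]\cong\mathbb Z_p[[T_1,T_2]]$, $\gamma_i\mapsto T_i+1$. $g(T_1,T_2)$ is the image of $\mathrm{char}_{\Lambda(G)}X(E/k_\infty)$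 (characteristic power series of the Pontryagin dual of the $p^\infty$-Selmer group of $E$ over $k_\infty$; taken to be $0$ if it is not torsion), and $L(T_1,T_2)$ is the image of the two-variable $p$-adic $L$-function $L_p(f,k)\in\Lambda(G)$ interpolating the values $L(f\times\Theta(\overline{\mathcal W}),1)/(8\pi^2\langle f,f\rangle_N)$ for finite order characters $\mathcal W$ of $G$. For a finite order character $\psi$ of $\Gamma$ (viewed on $\mathrm{Gal}(k_\infty/D_\infty)$), $\mathcal O_\psi$ is $\mathbb Z_p$ with the values of $\psi$ adjoined and $h(T_1,\psi(T_2))$ denotes the image of $h\in\mathbb Z_p[[T_1,T_2]]$ under $T_2\mapsto\psi(\gamma_2)-1$. -}

module Defs where

open import Level using (Level; _⊔_; 0ℓ)
open import Algebra.Bundles using (AbelianGroup; CommutativeRing; Semiring)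
open import Algebra.Structures using (IsCommutativeRing)
open import Algebra.Morphism.Structures
  using (module MonoidMorphisms; module RingMorphisms)
import Algebra.Definitions.RawMagma as RawMagmaDefinitions
import Algebra.Definitions.RawMonoid as RawMonoidDefinitions
import Algebra.Definitions.RawSemiring as RawSemiringDefinitions
import Algebra.Properties.CommutativeMonoid.Sum as Summation
import Algebra.Properties.CommutativeSemiring.Binomial as Binomial
import Algebra.Properties.CommutativeSemiring.Exp as CExp
import Algebra.Properties.Ring as RingProperties
import Algebra.Properties.AbelianGroup as AbelianGroupProperties
import Algebra.Properties.Semiring.Exp as Exp
import Algebra.Properties.Semiring.Mult as Mult
open import Data.Fin.Base using (Fin; zero; suc; toℕ; fromℕ; inject₁)
open import Data.Fin.Properties using (toℕ-fromℕ; toℕ-inject₁; toℕ<n)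
import Data.Integer.Properties as ℤₚ
open import Data.Nat.Base as ℕ using (ℕ; zero; suc; _≤_; _<_; z≤n; s≤s; _∸_; _!)
open import Data.Nat.Combinatorics using (_C_; nCn≡1; nCk≡n!/k![n-k]!; k![n∸k]!∣n!)
import Data.Nat.Divisibility as ℕ∣
open import Data.Nat.DivMod using (m/n*n≡m)
open import Data.Nat.Primality using (Prime; euclidsLemma; prime⇒nonZero; prime⇒nonTrivial)
import Data.Nat.Properties as ℕₚ
open import Data.Product.Base using (_,_)
open import Data.Sum.Base using (inj₁; inj₂)
open import Relation.Binary.PropositionalEquality as ≡ using (_≡_; _≢_)
open import Relation.Nullary.Negation using (¬_; contradiction)
open import Relation.Unary using (Pred)

module RingNotation {c ℓ : Level} (R : CommutativeRing c ℓ) where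
  open CommutativeRing R public hiding (zero)
  open RawMagmaDefinitions *-rawMagma public using (_∣_; _∤_; _,_)
  open RawMonoidDefinitions +-rawMonoid public using () renaming (_×_ to _·_)
  open RawSemiringDefinitions (Semiring.rawSemiring semiring) public using (_^_)
  open Summation +-commutativeMonoid public using (sum; sum-syntax)

  nat : ℕ → Carrier
  nat n = n · 1#

  ⟨_⟩ : Carrier → Pred Carrier (c ⊔ ℓ)
  ⟨ a ⟩ x = a ∣ x

------------------------------------------------------------------------

module _ {c ℓ : Level} (R : CommutativeRing c ℓ) (a : CommutativeRing.Carrier R) where
  open RingNotation R
  open RingProperties ring
    using (-‿distribˡ-*; [y-z]x≈yx-zx; x[y-z]≈xy-xz; -‿anti-homo-+; -0#≈0#; -‿involutive)
  open AbelianGroupProperties +-abelianGroup using () renaming (⁻¹-∙-comm to -‿+-comm)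
  open import Algebra.Properties.CommutativeSemigroup +-commutativeSemigroup
    using (interchange)
  open import Relation.Binary.Reasoning.Setoid setoid

  record CongruentMod (x y : Carrier) : Set (c ⊔ ℓ) where
    constructor congruent
    field
      divides-difference : a ∣ x - y

  private
    infix 4 _~_
    _~_ = CongruentMod

  ≈⇒≡mod : ∀ {x y} → x ≈ y → x ~ y
  ≈⇒≡mod {x} {y} x≈y = congruent (0# , (begin
    0# * a  ≈⟨ zeroˡ a ⟩
    0#      ≈⟨ -‿inverseʳ y ⟨
    y - y   ≈⟨ +-congʳ x≈y ⟨
    x - y   ∎))

  private
    ~-sym : ∀ {x y} → x ~ y → y ~ x
    ~-sym {x} {y} (congruent (q , qa)) = congruent (- q , (begin
      - q * a       ≈⟨ -‿distribˡ-* q a ⟨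
      - (q * a)     ≈⟨ -‿cong qa ⟩
      - (x - y)     ≈⟨ -‿anti-homo-+ x (- y) ⟩
      - - y - x     ≈⟨ +-congʳ (-‿involutive y) ⟩
      y - x         ∎))

    ~-+ : ∀ {x y u v} → x ~ y → u ~ v → x + u ~ y + v
    ~-+ {x} {y} {u} {v} (congruent (q , qa)) (congruent (r , ra)) = congruent (q + r , (begin
      (q + r) * a           ≈⟨ distribʳ a q r ⟩
      q * a + r * a         ≈⟨ +-cong qa ra ⟩
      (x - y) + (u - v)     ≈⟨ interchange x (- y) u (- v) ⟩
      (x + u) + (- y - v)   ≈⟨ +-congˡ (-‿+-comm y v) ⟩
      (x + u) - (y + v)     ∎))

    telescope : ∀ x y z → (x - y) + (y - z) ≈ x - z
    telescope x y z = begin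
      (x - y) + (y - z)      ≈⟨ +-assoc x (- y) (y - z) ⟩
      x + (- y + (y - z))    ≈⟨ +-congˡ (+-assoc (- y) y (- z)) ⟨
      x + ((- y + y) - z)    ≈⟨ +-congˡ (+-congʳ (-‿inverseˡ y)) ⟩
      x + (0# - z)           ≈⟨ +-congˡ (+-identityˡ (- z)) ⟩
      x - z                  ∎

    ~-trans : ∀ {x y z} → x ~ y → y ~ z → x ~ z
    ~-trans {x} {y} {z} (congruent (q , qa)) (congruent (r , ra)) = congruent (q + r , (begin
      (q + r) * a           ≈⟨ distribʳ a q r ⟩
      q * a + r * a         ≈⟨ +-cong qa ra ⟩
      (x - y) + (y - z)     ≈⟨ telescope x y z ⟩
      x - z                 ∎))

    ~-neg : ∀ {x y} → x ~ y → - x ~ - y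
    ~-neg {x} {y} (congruent (q , qa)) = congruent (- q , (begin
      - q * a       ≈⟨ -‿distribˡ-* q a ⟨
      - (q * a)     ≈⟨ -‿cong qa ⟩
      - (x - y)     ≈⟨ -‿+-comm x (- y) ⟨
      - x - - y     ∎))

    ~-* : ∀ {x y u v} → x ~ y → u ~ v → x * u ~ y * v
    ~-* {x} {y} {u} {v} (congruent (q , qa)) (congruent (r , ra)) =
      congruent (u * q + y * r , (begin
      (u * q + y * r) * a          ≈⟨ distribʳ a (u * q) (y * r) ⟩
      u * q * a + y * r * a        ≈⟨ +-cong (*-assoc u q a) (*-assoc y r a) ⟩
      u * (q * a) + y * (r * a)    ≈⟨ +-cong (*-congˡ qa) (*-congˡ ra) ⟩
      u * (x - y) + y * (u - v)    ≈⟨ +-congʳ (*-comm u (x - y)) ⟩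
      (x - y) * u + y * (u - v)    ≈⟨ +-cong ([y-z]x≈yx-zx u x y) (x[y-z]≈xy-xz y u v) ⟩
      (x * u - y * u) + (y * u - y * v) ≈⟨ telescope (x * u) (y * u) (y * v) ⟩
      x * u - y * v                ∎))

  abstract
    Quotient-isCommutativeRing :
      IsCommutativeRing CongruentMod _+_ _*_ -_ 0# 1#
    Quotient-isCommutativeRing = record
      { isRing = record
        { +-isAbelianGroup = record
          { isGroup = record
            { isMonoid = record
              { isSemigroup = record
                { isMagma = record
                  { isEquivalence = record
                    { refl = ≈⇒≡mod refl ; sym = ~-sym ; trans = ~-trans }
                  ; ∙-cong = ~-+
                  }
                ; assoc = λ x y z → ≈⇒≡mod (+-assoc x y z)
                }
              ; identity = (λ x → ≈⇒≡mod (+-identityˡ x)) , (λ x → ≈⇒≡mod (+-identityʳ x))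
              }
            ; inverse = (λ x → ≈⇒≡mod (-‿inverseˡ x)) , (λ x → ≈⇒≡mod (-‿inverseʳ x))
            ; ⁻¹-cong = ~-neg
            }
          ; comm = λ x y → ≈⇒≡mod (+-comm x y)
          }
        ; *-cong = ~-*
        ; *-assoc = λ x y z → ≈⇒≡mod (*-assoc x y z)
        ; *-identity = (λ x → ≈⇒≡mod (*-identityˡ x)) , (λ x → ≈⇒≡mod (*-identityʳ x))
        ; distrib = (λ x y z → ≈⇒≡mod (distribˡ x y z)) , (λ x y z → ≈⇒≡mod (distribʳ x y z))
        }
      ; *-comm = λ x y → ≈⇒≡mod (*-comm x y)
      }

  Quotient : CommutativeRing c (c ⊔ ℓ)
  Quotient .CommutativeRing.Carrier = Carrier
  Quotient .CommutativeRing._≈_ = CongruentMod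
  Quotient .CommutativeRing._+_ = _+_
  Quotient .CommutativeRing._*_ = _*_
  Quotient .CommutativeRing.-_ = -_
  Quotient .CommutativeRing.0# = 0#
  Quotient .CommutativeRing.1# = 1#
  Quotient .CommutativeRing.isCommutativeRing = Quotient-isCommutativeRing

  ∣⇒≡0mod : ∀ {x} → a ∣ x → CongruentMod x 0#
  ∣⇒≡0mod {x} (q , qa) = congruent (q , (begin
    q * a    ≈⟨ qa ⟩
    x        ≈⟨ +-identityʳ x ⟨
    x + 0#   ≈⟨ +-congˡ -0#≈0# ⟨
    x - 0#   ∎))

  ≡0mod⇒∣ : ∀ {x} → CongruentMod x 0# → a ∣ x
  ≡0mod⇒∣ {x} (congruent (q , qa)) = q , (begin
    q * a    ≈⟨ qa ⟩
    x - 0#   ≈⟨ +-congˡ -0#≈0# ⟩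
    x + 0#   ≈⟨ +-identityʳ x ⟩
    x        ∎)

------------------------------------------------------------------------

module _ {c ℓ : Level} (R : CommutativeRing c ℓ) where
  open RingNotation R
  open Summation +-commutativeMonoid using (sum-cong-≋; ∑-distrib-+; sum-replicate-zero)
  open import Algebra.Properties.Semiring.Sum semiring using (*-distribˡ-sum)
  open import Algebra.Properties.CommutativeSemigroup +-commutativeSemigroup
    using (x∙yz≈y∙xz)
  open RingProperties ring using (-0#≈0#)
  open import Relation.Binary.Reasoning.Setoid setoid

  Series : Set c
  Series = ℕ → Carrier

  record SeriesEq (f g : Series) : Set ℓ where
    constructor coefficientwise
    field
      at : ∀ n → f n ≈ g n

  open SeriesEq

  constant : Carrier → Series
  constant a zero    = a
  constant a (suc n) = 0#

  cauchy : Series → Series → Series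
  cauchy f g n = ∑[ i < suc n ] (f (toℕ i) * g (n ∸ toℕ i))

  private
    tail : Series → Series
    tail f n = f (suc n)

    cauchy-cong : ∀ {f f′ g g′} → (∀ n → f n ≈ f′ n) → (∀ n → g n ≈ g′ n) →
                  ∀ n → cauchy f g n ≈ cauchy f′ g′ n
    cauchy-cong f≈ g≈ n =
      sum-cong-≋ {suc n} λ i → *-cong (f≈ (toℕ i)) (g≈ (n ∸ toℕ i))

    cauchy-distribˡ : ∀ f g h n →
      cauchy f (λ i → g i + h i) n ≈ cauchy f g n + cauchy f h n
    cauchy-distribˡ f g h n = begin
      cauchy f (λ i → g i + h i) n
        ≈⟨ sum-cong-≋ {suc n} (λ i → distribˡ (f (toℕ i)) (g (n ∸ toℕ i)) (h (n ∸ toℕ i))) ⟩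
      ∑[ i < suc n ] (f (toℕ i) * g (n ∸ toℕ i) + f (toℕ i) * h (n ∸ toℕ i))
        ≈⟨ ∑-distrib-+ {suc n} (λ i → f (toℕ i) * g (n ∸ toℕ i)) (λ i → f (toℕ i) * h (n ∸ toℕ i)) ⟩
      cauchy f g n + cauchy f h n ∎

    cauchy-distribʳ : ∀ f g h n →
      cauchy (λ i → g i + h i) f n ≈ cauchy g f n + cauchy h f n
    cauchy-distribʳ f g h n = begin
      cauchy (λ i → g i + h i) f n
        ≈⟨ sum-cong-≋ {suc n} (λ i → distribʳ (f (n ∸ toℕ i)) (g (toℕ i)) (h (toℕ i))) ⟩
      ∑[ i < suc n ] (g (toℕ i) * f (n ∸ toℕ i) + h (toℕ i) * f (n ∸ toℕ i))
        ≈⟨ ∑-distrib-+ {suc n} (λ i → g (toℕ i) * f (n ∸ toℕ i)) (λ i → h (toℕ i) * f (n ∸ toℕ i)) ⟩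
      cauchy g f n + cauchy h f n ∎

    cauchy-scale : ∀ a f g n → cauchy (λ i → a * f i) g n ≈ a * cauchy f g n
    cauchy-scale a f g n = begin
      cauchy (λ i → a * f i) g n
        ≈⟨ sum-cong-≋ {suc n} (λ i → *-assoc a (f (toℕ i)) (g (n ∸ toℕ i))) ⟩
      ∑[ i < suc n ] (a * (f (toℕ i) * g (n ∸ toℕ i)))
        ≈⟨ *-distribˡ-sum {suc n} a (λ i → f (toℕ i) * g (n ∸ toℕ i)) ⟨
      a * cauchy f g n ∎

    cauchy-zeroˡ : ∀ f g n → (∀ i → f i ≈ 0#) → cauchy f g n ≈ 0#
    cauchy-zeroˡ f g n f≈0 = begin
      cauchy f g n
        ≈⟨ sum-cong-≋ {suc n} (λ i → trans (*-congʳ (f≈0 (toℕ i))) (zeroˡ (g (n ∸ toℕ i)))) ⟩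
      ∑[ i < suc n ] 0#   ≈⟨ sum-replicate-zero (suc n) ⟩
      0#                  ∎

    cauchy-assoc : ∀ f g h n → cauchy (cauchy f g) h n ≈ cauchy f (cauchy g h) n
    cauchy-assoc f g h zero = begin
      (f 0 * g 0 + 0#) * h 0 + 0#   ≈⟨ +-congʳ (*-congʳ (+-identityʳ _)) ⟩
      f 0 * g 0 * h 0 + 0#          ≈⟨ +-congʳ (*-assoc _ _ _) ⟩
      f 0 * (g 0 * h 0) + 0#        ≈⟨ +-congʳ (*-congˡ (+-identityʳ _)) ⟨
      f 0 * (g 0 * h 0 + 0#) + 0#   ∎
    cauchy-assoc f g h (suc n) = begin
      (f 0 * g 0 + 0#) * h (suc n) + cauchy (tail (cauchy f g)) h n
        ≈⟨ +-cong (*-congʳ (+-identityʳ _)) (cauchy-distribʳ h (λ i → f 0 * tail g i) (cauchy (tail f) g) n) ⟩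
      f 0 * g 0 * h (suc n) + (cauchy (λ i → f 0 * tail g i) h n + cauchy (cauchy (tail f) g) h n)
        ≈⟨ +-cong (*-assoc _ _ _) (+-cong (cauchy-scale (f 0) (tail g) h n) (cauchy-assoc (tail f) g h n)) ⟩
      f 0 * (g 0 * h (suc n)) + (f 0 * cauchy (tail g) h n + cauchy (tail f) (cauchy g h) n)
        ≈⟨ +-assoc _ _ _ ⟨
      f 0 * (g 0 * h (suc n)) + f 0 * cauchy (tail g) h n + cauchy (tail f) (cauchy g h) n
        ≈⟨ +-congʳ (distribˡ _ _ _) ⟨
      f 0 * (g 0 * h (suc n) + cauchy (tail g) h n) + cauchy (tail f) (cauchy g h) n ∎

    cauchy-unfoldʳ : ∀ f g n → cauchy f g (suc n) ≈ f (suc n) * g 0 + cauchy f (tail g) n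
    cauchy-unfoldʳ f g zero = x∙yz≈y∙xz _ _ _
    cauchy-unfoldʳ f g (suc n) = begin
      f 0 * g (suc (suc n)) + cauchy (tail f) g (suc n)
        ≈⟨ +-congˡ (cauchy-unfoldʳ (tail f) g n) ⟩
      f 0 * g (suc (suc n)) + (f (suc (suc n)) * g 0 + cauchy (tail f) (tail g) n)
        ≈⟨ x∙yz≈y∙xz _ _ _ ⟩
      f (suc (suc n)) * g 0 + (f 0 * g (suc (suc n)) + cauchy (tail f) (tail g) n) ∎

    cauchy-comm : ∀ f g n → cauchy f g n ≈ cauchy g f n
    cauchy-comm f g zero    = +-congʳ (*-comm _ _)
    cauchy-comm f g (suc n) = begin
      f 0 * g (suc n) + cauchy (tail f) g n   ≈⟨ +-cong (*-comm _ _) (cauchy-comm (tail f) g n) ⟩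
      g (suc n) * f 0 + cauchy g (tail f) n   ≈⟨ cauchy-unfoldʳ g f n ⟨
      cauchy g f (suc n)                      ∎

    cauchy-constantˡ : ∀ a f n → cauchy (constant a) f n ≈ a * f n
    cauchy-constantˡ a f zero    = +-identityʳ _
    cauchy-constantˡ a f (suc n) =
      trans (+-congˡ (cauchy-zeroˡ (tail (constant a)) f n λ _ → refl)) (+-identityʳ _)

    cauchy-identityˡ : ∀ f n → cauchy (constant 1#) f n ≈ f n
    cauchy-identityˡ f n = trans (cauchy-constantˡ 1# f n) (*-identityˡ (f n))

    cauchy-identityʳ : ∀ f n → cauchy f (constant 1#) n ≈ f n
    cauchy-identityʳ f n = trans (cauchy-comm f (constant 1#) n) (cauchy-identityˡ f n)

  abstract
    series-isCommutativeRing :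
      IsCommutativeRing SeriesEq (λ f g n → f n + g n) cauchy (λ f n → - f n) (λ _ → 0#) (constant 1#)
    series-isCommutativeRing = record
      { isRing = record
        { +-isAbelianGroup = record
          { isGroup = record
            { isMonoid = record
              { isSemigroup = record
                { isMagma = record
                  { isEquivalence = record
                    { refl = coefficientwise λ _ → refl
                    ; sym = λ e → coefficientwise λ n → sym (at e n)
                    ; trans = λ e e′ → coefficientwise λ n → trans (at e n) (at e′ n)
                    }
                  ; ∙-cong = λ e e′ → coefficientwise λ n → +-cong (at e n) (at e′ n)
                  }
                ; assoc = λ f g h → coefficientwise λ n → +-assoc (f n) (g n) (h n)
                }
              ; identity = (λ f → coefficientwise λ n → +-identityˡ (f n))
                         , (λ f → coefficientwise λ n → +-identityʳ (f n))
              }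
            ; inverse = (λ f → coefficientwise λ n → -‿inverseˡ (f n))
                      , (λ f → coefficientwise λ n → -‿inverseʳ (f n))
            ; ⁻¹-cong = λ e → coefficientwise λ n → -‿cong (at e n)
            }
          ; comm = λ f g → coefficientwise λ n → +-comm (f n) (g n)
          }
        ; *-cong = λ e e′ → coefficientwise (cauchy-cong (at e) (at e′))
        ; *-assoc = λ f g h → coefficientwise (cauchy-assoc f g h)
        ; *-identity = (λ f → coefficientwise (cauchy-identityˡ f))
                     , (λ f → coefficientwise (cauchy-identityʳ f))
        ; distrib = (λ f g h → coefficientwise (cauchy-distribˡ f g h))
                  , (λ f g h → coefficientwise (cauchy-distribʳ f g h))
        }
      ; *-comm = λ f g → coefficientwise (cauchy-comm f g)
      }

  infix 5 _⟦T⟧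
  _⟦T⟧ : CommutativeRing c ℓ
  _⟦T⟧ .CommutativeRing.Carrier = Series
  _⟦T⟧ .CommutativeRing._≈_ = SeriesEq
  _⟦T⟧ .CommutativeRing._+_ = λ f g n → f n + g n
  _⟦T⟧ .CommutativeRing._*_ = cauchy
  _⟦T⟧ .CommutativeRing.-_ = λ f n → - f n
  _⟦T⟧ .CommutativeRing.0# = λ _ → 0#
  _⟦T⟧ .CommutativeRing.1# = constant 1#
  _⟦T⟧ .CommutativeRing.isCommutativeRing = series-isCommutativeRing

  record Polynomial : Set (c ⊔ ℓ) where
    constructor polynomial
    field
      coefficient : Series
      bound       : ℕ
      vanishes    : ∀ i → bound ≤ i → coefficient i ≈ 0#

  open Polynomial

  record PolynomialEq (f g : Polynomial) : Set ℓ where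
    constructor coefficientwiseₚ
    field
      atₚ : SeriesEq (coefficient f) (coefficient g)

  open PolynomialEq

  private
    module S = CommutativeRing _⟦T⟧

    ≤-⊔ˡ : ∀ m n {i} → m ℕ.⊔ n ≤ i → m ≤ i
    ≤-⊔ˡ m n = ℕₚ.≤-trans (ℕₚ.m≤m⊔n m n)

    ≤-⊔ʳ : ∀ m n {i} → m ℕ.⊔ n ≤ i → n ≤ i
    ≤-⊔ʳ m n = ℕₚ.≤-trans (ℕₚ.m≤n⊔m m n)

    cauchy-vanishes : ∀ f g m n → (∀ i → m ≤ i → f i ≈ 0#) → (∀ i → n ≤ i → g i ≈ 0#) →
                      ∀ i → m ℕ.+ n ≤ i → cauchy f g i ≈ 0#
    cauchy-vanishes f g zero n f≈0 g≈0 i _ = cauchy-zeroˡ f g i (λ j → f≈0 j z≤n)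
    cauchy-vanishes f g (suc m) n f≈0 g≈0 (suc i) (s≤s m+n≤i) = begin
      f 0 * g (suc i) + cauchy (tail f) g i
        ≈⟨ +-cong (*-congˡ (g≈0 (suc i) (ℕₚ.m≤n⇒m≤1+n (ℕₚ.≤-trans (ℕₚ.m≤n+m n m) m+n≤i))))
                  (cauchy-vanishes (tail f) g m n (λ j m≤j → f≈0 (suc j) (s≤s m≤j)) g≈0 i m+n≤i) ⟩
      f 0 * 0# + 0#   ≈⟨ +-identityʳ _ ⟩
      f 0 * 0#        ≈⟨ zeroʳ _ ⟩
      0#              ∎

  constantₚ : Carrier → Polynomial
  constantₚ a = polynomial (constant a) 1 λ { (suc i) _ → refl }

  X : Polynomial
  X = polynomial coeff 2 vanishing
    where
    coeff : Series
    coeff 0             = 0#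
    coeff 1             = 1#
    coeff (suc (suc _)) = 0#
    vanishing : ∀ i → 2 ≤ i → coeff i ≈ 0#
    vanishing (suc zero)    (s≤s ())
    vanishing (suc (suc _)) _ = refl

  infixl 6 _+ₚ_
  infixl 7 _*ₚ_
  infix  8 -ₚ_

  _+ₚ_ _*ₚ_ : Polynomial → Polynomial → Polynomial
  f +ₚ g = polynomial (λ i → coefficient f i + coefficient g i) (bound f ℕ.⊔ bound g) λ i h →
    trans (+-cong (vanishes f i (≤-⊔ˡ (bound f) (bound g) h))
                  (vanishes g i (≤-⊔ʳ (bound f) (bound g) h)))
          (+-identityʳ 0#)
  f *ₚ g = polynomial (cauchy (coefficient f) (coefficient g)) (bound f ℕ.+ bound g)
    (cauchy-vanishes (coefficient f) (coefficient g) (bound f) (bound g) (vanishes f) (vanishes g))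

  -ₚ_ : Polynomial → Polynomial
  -ₚ f = polynomial (λ i → - coefficient f i) (bound f) λ i h →
    trans (-‿cong (vanishes f i h)) -0#≈0#

  0ₚ : Polynomial
  0ₚ = polynomial (λ _ → 0#) 0 (λ _ _ → refl)

  abstract
    polynomial-isCommutativeRing :
      IsCommutativeRing PolynomialEq _+ₚ_ _*ₚ_ -ₚ_ 0ₚ (constantₚ 1#)
    polynomial-isCommutativeRing = record
      { isRing = record
        { +-isAbelianGroup = record
          { isGroup = record
            { isMonoid = record
              { isSemigroup = record
                { isMagma = record
                  { isEquivalence = record
                    { refl = coefficientwiseₚ S.refl
                    ; sym = λ e → coefficientwiseₚ (S.sym (atₚ e))
                    ; trans = λ e e′ → coefficientwiseₚ (S.trans (atₚ e) (atₚ e′))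
                    }
                  ; ∙-cong = λ e e′ → coefficientwiseₚ (S.+-cong (atₚ e) (atₚ e′))
                  }
                ; assoc = λ f g h → coefficientwiseₚ
                    (S.+-assoc (coefficient f) (coefficient g) (coefficient h))
                }
              ; identity = (λ f → coefficientwiseₚ (S.+-identityˡ (coefficient f)))
                         , (λ f → coefficientwiseₚ (S.+-identityʳ (coefficient f)))
              }
            ; inverse = (λ f → coefficientwiseₚ (S.-‿inverseˡ (coefficient f)))
                      , (λ f → coefficientwiseₚ (S.-‿inverseʳ (coefficient f)))
            ; ⁻¹-cong = λ e → coefficientwiseₚ (S.-‿cong (atₚ e))
            }
          ; comm = λ f g → coefficientwiseₚ (S.+-comm (coefficient f) (coefficient g))
          }
        ; *-cong = λ e e′ → coefficientwiseₚ (S.*-cong (atₚ e) (atₚ e′))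
        ; *-assoc = λ f g h → coefficientwiseₚ
            (S.*-assoc (coefficient f) (coefficient g) (coefficient h))
        ; *-identity = (λ f → coefficientwiseₚ (S.*-identityˡ (coefficient f)))
                     , (λ f → coefficientwiseₚ (S.*-identityʳ (coefficient f)))
        ; distrib = (λ f g h → coefficientwiseₚ
                       (S.distribˡ (coefficient f) (coefficient g) (coefficient h)))
                  , (λ f g h → coefficientwiseₚ
                       (S.distribʳ (coefficient f) (coefficient g) (coefficient h)))
        }
      ; *-comm = λ f g → coefficientwiseₚ (S.*-comm (coefficient f) (coefficient g))
      }

  infix 5 _[X]
  _[X] : CommutativeRing (c ⊔ ℓ) ℓ
  _[X] .CommutativeRing.Carrier = Polynomial
  _[X] .CommutativeRing._≈_ = PolynomialEq
  _[X] .CommutativeRing._+_ = _+ₚ_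
  _[X] .CommutativeRing._*_ = _*ₚ_
  _[X] .CommutativeRing.-_ = -ₚ_
  _[X] .CommutativeRing.0# = 0ₚ
  _[X] .CommutativeRing.1# = constantₚ 1#
  _[X] .CommutativeRing.isCommutativeRing = polynomial-isCommutativeRing

  private
    module P = CommutativeRing _[X]

  constantₚ-isRingHomomorphism :
    RingMorphisms.IsRingHomomorphism rawRing P.rawRing constantₚ
  constantₚ-isRingHomomorphism = record
    { isSemiringHomomorphism = record
      { isNearSemiringHomomorphism = record
        { +-isMonoidHomomorphism = record
          { isMagmaHomomorphism = record
            { isRelHomomorphism = record
              { cong = λ x≈y → coefficientwiseₚ (coefficientwise λ
                  { zero → x≈y ; (suc _) → refl }) }
            ; homo = λ x y → coefficientwiseₚ (coefficientwise λ
                { zero → refl ; (suc _) → sym (+-identityʳ 0#) })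
            }
          ; ε-homo = coefficientwiseₚ (coefficientwise λ { zero → refl ; (suc _) → refl })
          }
        ; *-homo = λ x y → coefficientwiseₚ (coefficientwise λ
            { zero    → sym (cauchy-constantˡ x (constant y) zero)
            ; (suc n) → sym (trans (cauchy-constantˡ x (constant y) (suc n)) (zeroʳ x)) })
        }
      ; 1#-homo = P.refl
      }
    ; -‿homo = λ x → coefficientwiseₚ (coefficientwise λ
        { zero → refl ; (suc _) → sym -0#≈0# })
    }

------------------------------------------------------------------------
-- The p-adic completion of R is built as  lim R / p^k.

module _ {c ℓ : Level} (R : CommutativeRing c ℓ) (p : ℕ) where
  open RingNotation R

  R/p^ : ℕ → CommutativeRing c (c ⊔ ℓ)
  R/p^ k = Quotient R (nat p ^ k)

  private
    module Q (k : ℕ) = CommutativeRing (R/p^ k)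

  record Compatible : Set (c ⊔ ℓ) where
    constructor compatible
    field
      approx   : ℕ → Carrier
      coherent : ∀ k → Q._≈_ k (approx (suc k)) (approx k)

  open Compatible

  record CompatibleEq (x y : Compatible) : Set (c ⊔ ℓ) where
    constructor levelwise
    field
      at-level : ∀ k → Q._≈_ k (approx x k) (approx y k)

  open CompatibleEq

  diagonal : Carrier → Compatible
  diagonal a = compatible (λ _ → a) (λ k → Q.refl k)

  infixl 6 _+ᶜ_
  infixl 7 _*ᶜ_
  infix  8 -ᶜ_

  _+ᶜ_ _*ᶜ_ : Compatible → Compatible → Compatible
  x +ᶜ y = compatible (λ k → approx x k + approx y k)
                      (λ k → Q.+-cong k (coherent x k) (coherent y k))
  x *ᶜ y = compatible (λ k → approx x k * approx y k)
                      (λ k → Q.*-cong k (coherent x k) (coherent y k))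

  -ᶜ_ : Compatible → Compatible
  -ᶜ x = compatible (λ k → - approx x k) (λ k → Q.-‿cong k (coherent x k))

  abstract
    Completion-isCommutativeRing :
      IsCommutativeRing CompatibleEq _+ᶜ_ _*ᶜ_ -ᶜ_ (diagonal 0#) (diagonal 1#)
    Completion-isCommutativeRing = record
      { isRing = record
        { +-isAbelianGroup = record
          { isGroup = record
            { isMonoid = record
              { isSemigroup = record
                { isMagma = record
                  { isEquivalence = record
                    { refl = levelwise λ k → Q.refl k
                    ; sym = λ e → levelwise λ k → Q.sym k (at-level e k)
                    ; trans = λ e e′ → levelwise λ k → Q.trans k (at-level e k) (at-level e′ k)
                    }
                  ; ∙-cong = λ e e′ → levelwise λ k → Q.+-cong k (at-level e k) (at-level e′ k)
                  }
                ; assoc = λ x y z → levelwise λ k →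
                    Q.+-assoc k (approx x k) (approx y k) (approx z k)
                }
              ; identity = (λ x → levelwise λ k → Q.+-identityˡ k (approx x k))
                         , (λ x → levelwise λ k → Q.+-identityʳ k (approx x k))
              }
            ; inverse = (λ x → levelwise λ k → Q.-‿inverseˡ k (approx x k))
                      , (λ x → levelwise λ k → Q.-‿inverseʳ k (approx x k))
            ; ⁻¹-cong = λ e → levelwise λ k → Q.-‿cong k (at-level e k)
            }
          ; comm = λ x y → levelwise λ k → Q.+-comm k (approx x k) (approx y k)
          }
        ; *-cong = λ e e′ → levelwise λ k → Q.*-cong k (at-level e k) (at-level e′ k)
        ; *-assoc = λ x y z → levelwise λ k →
            Q.*-assoc k (approx x k) (approx y k) (approx z k)
        ; *-identity = (λ x → levelwise λ k → Q.*-identityˡ k (approx x k))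
                     , (λ x → levelwise λ k → Q.*-identityʳ k (approx x k))
        ; distrib = (λ x y z → levelwise λ k →
                       Q.distribˡ k (approx x k) (approx y k) (approx z k))
                  , (λ x y z → levelwise λ k →
                       Q.distribʳ k (approx x k) (approx y k) (approx z k))
        }
      ; *-comm = λ x y → levelwise λ k → Q.*-comm k (approx x k) (approx y k)
      }

  Completion : CommutativeRing (c ⊔ ℓ) (c ⊔ ℓ)
  Completion .CommutativeRing.Carrier = Compatible
  Completion .CommutativeRing._≈_ = CompatibleEq
  Completion .CommutativeRing._+_ = _+ᶜ_
  Completion .CommutativeRing._*_ = _*ᶜ_
  Completion .CommutativeRing.-_ = -ᶜ_
  Completion .CommutativeRing.0# = diagonal 0#
  Completion .CommutativeRing.1# = diagonal 1#
  Completion .CommutativeRing.isCommutativeRing = Completion-isCommutativeRing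

  private
    module C = RingNotation Completion

    approx-nat : ∀ n k → approx (C.nat n) k ≡ nat n
    approx-nat zero    k = ≡.refl
    approx-nat (suc n) k = ≡.cong (1# +_) (approx-nat n k)

    approx-^ : ∀ x n k → approx (x C.^ n) k ≡ approx x k ^ n
    approx-^ x zero    k = ≡.refl
    approx-^ x (suc n) k = ≡.cong (approx x k *_) (approx-^ x n k)

    approx-p^ : ∀ k j → approx (C.nat p C.^ k) j ≡ nat p ^ k
    approx-p^ k j = ≡.trans (approx-^ (C.nat p) k j) (≡.cong (_^ k) (approx-nat p j))

    ∣⇒level-0 : ∀ k x → C.nat p C.^ k C.∣ x → Q._≈_ k (approx x k) 0#
    ∣⇒level-0 k x (q C., e) = Q.trans k (Q.sym k (at-level e k))
      (∣⇒≡0mod R (nat p ^ k)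
        (approx q k , *-congˡ (reflexive (≡.sym (approx-p^ k k)))))

  -- The limit of a sequence S of elements of the completion whose k-th
  -- difference is divisible by p^k; it agrees with S k modulo p^k.
  limit : (S : ℕ → Compatible) →
          (∀ k → C.nat p C.^ k C.∣ (S (suc k) C.- S k)) → Compatible
  limit S cauchy = compatible (λ k → approx (S k) k) λ k →
    Q.trans k (coherent (S (suc k)) k)
      (x-y≈0⇒x≈y k (∣⇒level-0 k (S (suc k) C.- S k) (cauchy k)))
    where
    x-y≈0⇒x≈y : ∀ k {x y} → Q._≈_ k (x - y) 0# → Q._≈_ k x y
    x-y≈0⇒x≈y k e = congruent (≡0mod⇒∣ R (nat p ^ k) e)

------------------------------------------------------------------------

module _ {c ℓ c′ ℓ′ : Level} {R : CommutativeRing c ℓ} {S : CommutativeRing c′ ℓ′} (p : ℕ)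
  {φ : CommutativeRing.Carrier R → CommutativeRing.Carrier S}
  (φ-hom : RingMorphisms.IsRingHomomorphism
             (CommutativeRing.rawRing R) (CommutativeRing.rawRing S) φ) where
  private
    module R = RingNotation R
    module S = RingNotation S
    open RingMorphisms.IsRingHomomorphism φ-hom
    open Compatible

    φ-nat : ∀ n → φ (R.nat n) S.≈ S.nat n
    φ-nat zero    = 0#-homo
    φ-nat (suc n) = S.trans (+-homo _ _) (S.+-cong 1#-homo (φ-nat n))

    φ-^ : ∀ x n → φ (x R.^ n) S.≈ φ x S.^ n
    φ-^ x zero    = 1#-homo
    φ-^ x (suc n) = S.trans (*-homo _ _) (S.*-congˡ (φ-^ x n))

    φ-p^ : ∀ k → φ (R.nat p R.^ k) S.≈ S.nat p S.^ k
    φ-p^ k = S.trans (φ-^ (R.nat p) k) (Exp.^-congˡ S.semiring k (φ-nat p))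

  Completion-map : Compatible R p → Compatible S p
  Completion-map x = compatible (λ k → φ (approx x k)) λ k → lift k (coherent x k)
    where
    open import Relation.Binary.Reasoning.Setoid S.setoid
    lift : ∀ k {a b} → CongruentMod R (R.nat p R.^ k) a b →
           CongruentMod S (S.nat p S.^ k) (φ a) (φ b)
    lift k {a} {b} (congruent (q R., e)) = congruent (φ q S., (begin
      φ q S.* S.nat p S.^ k     ≈⟨ S.*-congˡ (φ-p^ k) ⟨
      φ q S.* φ (R.nat p R.^ k) ≈⟨ *-homo _ _ ⟨
      φ (q R.* R.nat p R.^ k)   ≈⟨ ⟦⟧-cong e ⟩
      φ (a R.- b)               ≈⟨ +-homo _ _ ⟩
      φ a S.+ φ (R.- b)         ≈⟨ S.+-congˡ (-‿homo _) ⟩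
      φ a S.- φ b               ∎))

------------------------------------------------------------------------
-- If (1 + u)^(p^n) = 1 then p divides u^(p^n); this makes power series
-- converge at u.

module _ {p : ℕ} (p-prime : Prime p) where
  private
    instance
      _ = prime⇒nonZero p-prime
      _ = prime⇒nonTrivial p-prime

    p∤m! : ∀ {m} → m < p → ¬ p ℕ∣.∣ m !
    p∤m! {zero}  m<p p∣1 = ℕ∣.>⇒∤ (ℕ.nonTrivial⇒n>1 p) p∣1
    p∤m! {suc m} m<p p∣m! with euclidsLemma (suc m) (m !) p-prime p∣m!
    ... | inj₁ p∣1+m = ℕ∣.>⇒∤ m<p p∣1+m
    ... | inj₂ p∣m!′ = p∤m! (ℕₚ.<-trans (ℕₚ.n<1+n m) m<p) p∣m!′

    p∣p! : p ℕ∣.∣ p !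
    p∣p! = go p (ℕ.≢-nonZero⁻¹ p)
      where
      go : ∀ n → n ≢ 0 → n ℕ∣.∣ n !
      go zero    0≢0 = contradiction ≡.refl 0≢0
      go (suc m) _   = ℕ∣.m∣m*n (m !)

    p∣pCk : ∀ {k} → 0 < k → k < p → p ℕ∣.∣ p C k
    p∣pCk {k} 0<k k<p with euclidsLemma (p C k) (k ! ℕ.* (p ∸ k) !) p-prime divides
      where
      instance _ = ℕₚ._!*_!≢0 k (p ∸ k)
      divides : p ℕ∣.∣ (p C k) ℕ.* (k ! ℕ.* (p ∸ k) !)
      divides = ≡.subst (p ℕ∣.∣_)
        (≡.sym (≡.trans (≡.cong (ℕ._* (k ! ℕ.* (p ∸ k) !)) (nCk≡n!/k![n-k]! (ℕₚ.<⇒≤ k<p)))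
                        (m/n*n≡m (k![n∸k]!∣n! (ℕₚ.<⇒≤ k<p)))))
        p∣p!
    ... | inj₁ yes = yes
    ... | inj₂ no with euclidsLemma (k !) ((p ∸ k) !) p-prime no
    ...   | inj₁ bad = contradiction bad (p∤m! k<p)
    ...   | inj₂ bad = contradiction bad (p∤m! (ℕₚ.∸-monoʳ-< 0<k (ℕₚ.<⇒≤ k<p)))

  module _ {c ℓ : Level} (S : CommutativeRing c ℓ) where
    open RingNotation S
    module _ (p≈0 : nat p ≈ 0#) where
      open import Relation.Binary.Reasoning.Setoid setoid
      open Exp semiring using (^-congˡ; ^-assocʳ; ^-congʳ)
      open Mult semiring
        using (×-assocˡ; ×-assoc-*; ×-congʳ; ×-congˡ; ×-homo-1)

      p·≈0 : ∀ x → p · x ≈ 0#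
      p·≈0 x = begin
        p · x          ≈⟨ ×-congʳ p (*-identityˡ x) ⟨
        p · (1# * x)   ≈⟨ ×-assoc-* p 1# x ⟨
        nat p * x      ≈⟨ *-congʳ p≈0 ⟩
        0# * x         ≈⟨ zeroˡ x ⟩
        0#             ∎

      multiple·≈0 : ∀ {m} x → p ℕ∣.∣ m → m · x ≈ 0#
      multiple·≈0 {m} x (ℕ∣.divides q m≡q*p) = begin
        m · x            ≈⟨ ×-congˡ (≡.trans m≡q*p (ℕₚ.*-comm q p)) ⟩
        (p ℕ.* q) · x    ≈⟨ ×-assocˡ x p q ⟨
        p · (q · x)      ≈⟨ p·≈0 (q · x) ⟩
        0#               ∎

      1^ : ∀ n → 1# ^ n ≈ 1#
      1^ zero    = refl
      1^ (suc n) = trans (*-identityˡ _) (1^ n)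

      frobenius : ∀ x → (x + 1#) ^ p ≈ x ^ p + 1#
      frobenius x = trans (Binomial.theorem commutativeSemiring p x 1#) (go p ≡.refl)
        where
        open Summation +-commutativeMonoid
          using (sum-cong-≋; sum-init-last; sum-replicate-zero)
        term : ∀ n → Fin (suc n) → Carrier
        term n k = (n C toℕ k) · (x ^ toℕ k * 1# ^ (n ∸ toℕ k))

        go : ∀ n → n ≡ p → sum (term n) ≈ x ^ n + 1#
        go zero    0≡p = contradiction (≡.sym 0≡p) (ℕ.≢-nonZero⁻¹ p)
        go (suc m) 1+m≡p = begin
          term (suc m) zero + sum rest   ≈⟨ +-cong first (sum-init-last rest) ⟩
          1# + (sum middle + final)      ≈⟨ +-congˡ (+-cong middle≈0 final≈) ⟩
          1# + (0# + x ^ suc m)          ≈⟨ +-congˡ (+-identityˡ _) ⟩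
          1# + x ^ suc m                 ≈⟨ +-comm _ _ ⟩
          x ^ suc m + 1#                 ∎
          where
          rest : Fin (suc m) → Carrier
          rest k = term (suc m) (suc k)
          middle : Fin m → Carrier
          middle k = rest (inject₁ k)
          final : Carrier
          final = rest (fromℕ m)

          first : term (suc m) zero ≈ 1#
          first = begin
            1 · (1# * 1# ^ suc m)   ≈⟨ ×-homo-1 _ ⟩
            1# * 1# ^ suc m         ≈⟨ *-identityˡ _ ⟩
            1# ^ suc m              ≈⟨ 1^ (suc m) ⟩
            1#                      ∎

          middle≈0 : sum middle ≈ 0#
          middle≈0 = trans
            (sum-cong-≋ {m} λ k → multiple·≈0 _
              (≡.subst (λ n → p ℕ∣.∣ n C suc (toℕ (inject₁ k))) (≡.sym 1+m≡p)
                (p∣pCk (s≤s z≤n)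
                  (≡.subst (suc (toℕ (inject₁ k)) <_) 1+m≡p
                    (s≤s (≡.subst (_< m) (≡.sym (toℕ-inject₁ k)) (toℕ<n k)))))))
            (sum-replicate-zero m)

          final≈ : final ≈ x ^ suc m
          final≈ = begin
            (suc m C suc (toℕ (fromℕ m))) · (x ^ suc (toℕ (fromℕ m)) * 1# ^ (m ∸ toℕ (fromℕ m)))
              ≡⟨ ≡.cong (λ j → (suc m C suc j) · (x ^ suc j * 1# ^ (m ∸ j))) (toℕ-fromℕ m) ⟩
            (suc m C suc m) · (x ^ suc m * 1# ^ (m ∸ m))
              ≈⟨ ×-congˡ (nCn≡1 (suc m)) ⟩
            1 · (x ^ suc m * 1# ^ (m ∸ m))   ≈⟨ ×-homo-1 _ ⟩
            x ^ suc m * 1# ^ (m ∸ m)         ≈⟨ *-congˡ (1^ (m ∸ m)) ⟩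
            x ^ suc m * 1#                   ≈⟨ *-identityʳ _ ⟩
            x ^ suc m                        ∎

      frobeniusⁿ : ∀ n x → (x + 1#) ^ (p ℕ.^ n) ≈ x ^ (p ℕ.^ n) + 1#
      frobeniusⁿ zero    x = trans (*-identityʳ _) (+-congʳ (sym (*-identityʳ _)))
      frobeniusⁿ (suc n) x = begin
        (x + 1#) ^ (p ℕ.* p ℕ.^ n)     ≈⟨ ^-congʳ (x + 1#) (ℕₚ.*-comm p (p ℕ.^ n)) ⟩
        (x + 1#) ^ (p ℕ.^ n ℕ.* p)     ≈⟨ ^-assocʳ (x + 1#) (p ℕ.^ n) p ⟨
        ((x + 1#) ^ (p ℕ.^ n)) ^ p     ≈⟨ ^-congˡ p (frobeniusⁿ n x) ⟩
        (x ^ (p ℕ.^ n) + 1#) ^ p       ≈⟨ frobenius (x ^ (p ℕ.^ n)) ⟩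
        (x ^ (p ℕ.^ n)) ^ p + 1#       ≈⟨ +-congʳ (^-assocʳ x (p ℕ.^ n) p) ⟩
        x ^ (p ℕ.^ n ℕ.* p) + 1#       ≈⟨ +-congʳ (^-congʳ x (ℕₚ.*-comm (p ℕ.^ n) p)) ⟩
        x ^ (p ℕ.* p ℕ.^ n) + 1#       ∎

      nilpotent : ∀ n z → z ^ (p ℕ.^ n) ≈ 1# → (z - 1#) ^ (p ℕ.^ n) ≈ 0#
      nilpotent n z z^≈1 = +-cancelʳ 1# _ _ (begin
        (z - 1#) ^ (p ℕ.^ n) + 1#     ≈⟨ frobeniusⁿ n (z - 1#) ⟨
        (z - 1# + 1#) ^ (p ℕ.^ n)     ≈⟨ ^-congˡ (p ℕ.^ n) z-1+1≈z ⟩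
        z ^ (p ℕ.^ n)                 ≈⟨ z^≈1 ⟩
        1#                            ≈⟨ +-identityˡ 1# ⟨
        0# + 1#                       ∎)
        where
        open RingProperties ring using (+-cancelʳ)
        z-1+1≈z : z - 1# + 1# ≈ z
        z-1+1≈z = trans (+-assoc _ _ _) (trans (+-congˡ (-‿inverseˡ 1#)) (+-identityʳ z))

  p∣[ζ-1]^ : {c ℓ : Level} (S : CommutativeRing c ℓ) → let open RingNotation S in
    ∀ n ζ → ζ ^ (p ℕ.^ n) ≈ 1# → nat p ∣ (ζ - 1#) ^ (p ℕ.^ n)
  p∣[ζ-1]^ S n ζ ζ^≈1 = ≡0mod⇒∣ S (nat p)
    (≡.subst (λ x → CongruentMod S (nat p) x 0#) (Q-^ (ζ - 1#) (p ℕ.^ n))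
      (nilpotent Q p≡0 n ζ
        (≡.subst (λ x → CongruentMod S (nat p) x 1#) (≡.sym (Q-^ ζ (p ℕ.^ n)))
          (≈⇒≡mod S (nat p) ζ^≈1))))
    where
    open RingNotation S
    Q : CommutativeRing _ _
    Q = Quotient S (nat p)
    module Q = RingNotation Q

    Q-nat : ∀ m → Q.nat m ≡ nat m
    Q-nat zero    = ≡.refl
    Q-nat (suc m) = ≡.cong (1# +_) (Q-nat m)

    Q-^ : ∀ x m → x Q.^ m ≡ x ^ m
    Q-^ x zero    = ≡.refl
    Q-^ x (suc m) = ≡.cong (x *_) (Q-^ x m)

    p≡0 : Q.nat p Q.≈ Q.0#
    p≡0 = ≡.subst (λ x → CongruentMod S (nat p) x 0#) (≡.sym (Q-nat p))
      (∣⇒≡0mod S (nat p) (1# , *-identityˡ (nat p)))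

------------------------------------------------------------------------

module _ {c ℓ : Level} (S : CommutativeRing c ℓ) where
  open RingNotation S
  open import Relation.Binary.Reasoning.Setoid setoid
  open Summation +-commutativeMonoid using (sum-init-last; sum-cong-≗)

  Σ< : (ℕ → Carrier) → ℕ → Carrier
  Σ< f k = ∑[ j < k ] f (toℕ j)

  Σ<-suc : ∀ f m → Σ< f (suc m) ≈ Σ< f m + f m
  Σ<-suc f m = trans (sum-init-last {m} (λ j → f (toℕ j)))
    (+-cong (reflexive (sum-cong-≗ {m} (λ j → ≡.cong f (toℕ-inject₁ j))))
            (reflexive (≡.cong f (toℕ-fromℕ m))))

  extend-quotient : ∀ d a b c e q r → q * d ≈ a - b → r * d ≈ c → e ≈ a + c → (q + r) * d ≈ e - b
  extend-quotient d a b c e q r qd rd eq = begin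
      (q + r) * d         ≈⟨ distribʳ d q r ⟩
      q * d + r * d       ≈⟨ +-cong qd rd ⟩
      (a - b) + c         ≈⟨ +-assoc a (- b) c ⟩
      a + (- b + c)       ≈⟨ +-congˡ (+-comm (- b) c) ⟩
      a + (c - b)         ≈⟨ +-assoc a c (- b) ⟨
      (a + c) - b         ≈⟨ +-congʳ eq ⟨
      e - b               ∎

  difference-divisible : ∀ d (f : ℕ → Carrier) m l → (∀ j → l ≤ j → d ∣ f j) →
      d ∣ (Σ< f (m ℕ.+ l) - Σ< f l)
  difference-divisible d f zero l d∣f = 0# , trans (zeroˡ d) (sym (-‿inverseʳ (Σ< f l)))
  difference-divisible d f (suc m) l d∣f = go (difference-divisible d f m l d∣f) (d∣f (m ℕ.+ l) (ℕₚ.m≤n+m l m))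
    where
    go : d ∣ (Σ< f (m ℕ.+ l) - Σ< f l) → d ∣ f (m ℕ.+ l) → d ∣ (Σ< f (suc m ℕ.+ l) - Σ< f l)
    go (q , qd) (r , rd) = q + r , extend-quotient d (Σ< f (m ℕ.+ l)) (Σ< f l) (f (m ℕ.+ l)) (Σ< f (suc m ℕ.+ l)) q r qd rd (Σ<-suc f (m ℕ.+ l))

  open Exp semiring using (^-homo-*; ^-assocʳ; ^-congˡ; ^-congʳ)

  ∣-power : ∀ d u J k j → d ∣ u ^ J → k ℕ.* J ≤ j → d ^ k ∣ u ^ j
  ∣-power d u J k j (q , qd≈u^J) kJ≤j = u ^ r * q ^ k , (begin
    u ^ r * q ^ k * d ^ k       ≈⟨ *-assoc (u ^ r) (q ^ k) (d ^ k) ⟩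
    u ^ r * (q ^ k * d ^ k)     ≈⟨ *-congˡ (CExp.^-distrib-* commutativeSemiring q d k) ⟨
    u ^ r * (q * d) ^ k         ≈⟨ *-congˡ (^-congˡ k qd≈u^J) ⟩
    u ^ r * (u ^ J) ^ k         ≈⟨ *-congˡ (^-assocʳ u J k) ⟩
    u ^ r * u ^ (J ℕ.* k)       ≈⟨ *-congˡ (^-congʳ u (ℕₚ.*-comm J k)) ⟩
    u ^ r * u ^ (k ℕ.* J)       ≈⟨ ^-homo-* u r (k ℕ.* J) ⟨
    u ^ (r ℕ.+ k ℕ.* J)         ≈⟨ ^-congʳ u (ℕₚ.m∸n+n≡m kJ≤j) ⟩
    u ^ j                       ∎)
    where
    r : ℕ
    r = j ∸ k ℕ.* J

  ∣-term : ∀ d b x → d ∣ x → d ∣ b * x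
  ∣-term d b x (q , e) = b * q , trans (*-assoc b q d) (*-congˡ e)

  partial : (ℕ → Carrier) → Carrier → ℕ → Carrier
  partial b u N = ∑[ j < N ] (b (toℕ j) * u ^ toℕ j)

  converges : ∀ d u J → d ∣ u ^ J → ∀ b k →
    d ^ k ∣ (partial b u (suc k ℕ.* J) - partial b u (k ℕ.* J))
  converges d u J d∣u^J b k =
    difference-divisible (d ^ k) (λ j → b j * u ^ j) J (k ℕ.* J) λ j kJ≤j →
      ∣-term (d ^ k) (b j) (u ^ j) (∣-power d u J k j d∣u^J kJ≤j)

module _ {c ℓ : Level} {p : ℕ} (p-prime : Prime p) (A : CommutativeRing c ℓ) where
  private
    module 𝒪 = RingNotation (Completion A p)

  -- Σⱼ bⱼ (z - 1)ʲ.  The k-th partial sum stops at j = k p^n, as p^k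
  -- divides all further powers of z - 1.
  evaluate : (n : ℕ) (z : 𝒪.Carrier) → z 𝒪.^ (p ℕ.^ n) 𝒪.≈ 𝒪.1# → (ℕ → 𝒪.Carrier) → 𝒪.Carrier
  evaluate n z z^p^n≈1 b =
    limit A p (λ k → partial (Completion A p) b (z 𝒪.- 𝒪.1#) (k ℕ.* p ℕ.^ n))
      (converges (Completion A p) (𝒪.nat p) (z 𝒪.- 𝒪.1#) (p ℕ.^ n)
        (p∣[ζ-1]^ p-prime (Completion A p) n z z^p^n≈1) b)

-- A character  Γ → 𝒪ˣ  of exact order N.
record CharacterOfOrder {c ℓ c′ ℓ′ : Level} (N : ℕ)
  (Γ : AbelianGroup c ℓ) (𝒪 : CommutativeRing c′ ℓ′) : Set (c ⊔ ℓ ⊔ c′ ⊔ ℓ′) where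
  private
    module Γ = AbelianGroup Γ
    module 𝒪 = RingNotation 𝒪
  field
    ψ              : Γ.Carrier → 𝒪.Carrier
    isHomomorphism : MonoidMorphisms.IsMonoidHomomorphism Γ.rawMonoid 𝒪.*-rawMonoid ψ
    order-divides  : ∀ x → ψ x 𝒪.^ N 𝒪.≈ 𝒪.1#
    order-least    : ∀ m → (∀ x → ψ x 𝒪.^ m 𝒪.≈ 𝒪.1#) → N ℕ∣.∣ m

module _ {c ℓ c′ ℓ′ : Level} {p : ℕ} (p-prime : Prime p)
  {Γ : AbelianGroup c ℓ} (A : CommutativeRing c′ ℓ′) (n : ℕ) where
  private
    module Γ = AbelianGroup Γ
    module 𝒪 = CommutativeRing (Completion A p)

  -- Σⱼ bⱼ (ψ(γ) - 1)ʲ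
  evaluateAt : CharacterOfOrder (p ℕ.^ n) Γ (Completion A p) → Γ.Carrier →
               (ℕ → 𝒪.Carrier) → 𝒪.Carrier
  evaluateAt χ γ = evaluate p-prime A n (ψ γ) (order-divides γ)
    where open CharacterOfOrder χ

------------------------------------------------------------------------

ℤ-ring : CommutativeRing 0ℓ 0ℓ
ℤ-ring = ℤₚ.+-*-commutativeRing

ℤ[X] : CommutativeRing 0ℓ 0ℓ
ℤ[X] = ℤ-ring [X]

-- The p^n-th cyclotomic polynomial (for p prime):  X - 1  if n = 0, and
-- 1 + Y + ... + Y^(p-1)  with  Y = X^(p^(n-1))  otherwise.
Φ : ℕ → ℕ → CommutativeRing.Carrier ℤ[X]
Φ p zero    = X ℤ-ring - 1#
  where open RingNotation ℤ[X]
Φ p (suc n) = ∑[ i < p ] ((X ℤ-ring ^ (p ℕ.^ n)) ^ toℕ i)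
  where open RingNotation ℤ[X]

ℤ[ζ] : ℕ → ℕ → CommutativeRing 0ℓ 0ℓ
ℤ[ζ] p n = Quotient ℤ[X] (Φ p n)

ℤ⟨_⟩ : ℕ → CommutativeRing 0ℓ 0ℓ
ℤ⟨ p ⟩ = Completion ℤ-ring p

-- ℤ_p[ζ] for a primitive p^n-th root of unity ζ.  Since ℤ[ζ] is finite
-- free over ℤ, ℤ_p ⊗ ℤ[ζ] is the p-adic completion of ℤ[ζ].
ℤ⟨_⟩[ζ_] : ℕ → ℕ → CommutativeRing 0ℓ 0ℓ
ℤ⟨ p ⟩[ζ n ] = Completion (ℤ[ζ] p n) p

private
  module H = RingMorphisms.IsRingHomomorphism (constantₚ-isRingHomomorphism ℤ-ring)

ℤ→ℤ[ζ]-isRingHomomorphism : ∀ p n →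
  RingMorphisms.IsRingHomomorphism (CommutativeRing.rawRing ℤ-ring)
    (CommutativeRing.rawRing (ℤ[ζ] p n)) (constantₚ ℤ-ring)
ℤ→ℤ[ζ]-isRingHomomorphism p n = record
  { isSemiringHomomorphism = record
    { isNearSemiringHomomorphism = record
      { +-isMonoidHomomorphism = record
        { isMagmaHomomorphism = record
          { isRelHomomorphism = record { cong = λ e → down (H.⟦⟧-cong e) }
          ; homo = λ x y → down (H.+-homo x y)
          }
        ; ε-homo = down H.0#-homo
        }
      ; *-homo = λ x y → down (H.*-homo x y)
      }
    ; 1#-homo = down H.1#-homo
    }
  ; -‿homo = λ x → down (H.-‿homo x)
  }
  where
  down : ∀ {x y} → CommutativeRing._≈_ ℤ[X] x y → CommutativeRing._≈_ (ℤ[ζ] p n) x y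
  down = ≈⇒≡mod ℤ[X] (Φ p n)

ι : ∀ p n → CommutativeRing.Carrier ℤ⟨ p ⟩ → CommutativeRing.Carrier ℤ⟨ p ⟩[ζ n ]
ι p n = Completion-map p (ℤ→ℤ[ζ]-isRingHomomorphism p n)

-- Γ, isomorphic to ℤ_p through its topological generator γ₂.
Γ⟨_⟩ : ℕ → AbelianGroup 0ℓ 0ℓ
Γ⟨ p ⟩ = CommutativeRing.+-abelianGroup ℤ⟨ p ⟩

γ₂ : ∀ p → AbelianGroup.Carrier Γ⟨ p ⟩
γ₂ p = CommutativeRing.1# ℤ⟨ p ⟩

-- A finite order character ψ of Γ has order p^n for some n and is
-- automatically continuous.  Its values are exactly the p^n-th roots of
-- unity, so 𝒪_ψ = ℤ_p[ζ] with ζ of order p^n.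
record FiniteOrderCharacter (p : ℕ) : Set where
  field
    n         : ℕ
    character : CharacterOfOrder (p ℕ.^ n) Γ⟨ p ⟩ ℤ⟨ p ⟩[ζ n ]

  𝒪 : CommutativeRing 0ℓ 0ℓ
  𝒪 = ℤ⟨ p ⟩[ζ n ]

  open CharacterOfOrder character public

-- ℤ_p[[T₁,T₂]] = ℤ_p[[T₂]][[T₁]]
ℤ⟨_⟩⟦T₁,T₂⟧ : ℕ → CommutativeRing 0ℓ 0ℓ
ℤ⟨ p ⟩⟦T₁,T₂⟧ = (ℤ⟨ p ⟩ ⟦T⟧) ⟦T⟧

_[T₁,0] : ∀ {p} → CommutativeRing.Carrier ℤ⟨ p ⟩⟦T₁,T₂⟧ → CommutativeRing.Carrier (ℤ⟨ p ⟩ ⟦T⟧)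
(h [T₁,0]) i = h i 0

-- h(T₁,ψ(T₂)):  T₂ ↦ ψ(γ₂) - 1
specialise : ∀ {p} → Prime p → (χ : FiniteOrderCharacter p) →
  CommutativeRing.Carrier ℤ⟨ p ⟩⟦T₁,T₂⟧ →
  CommutativeRing.Carrier (FiniteOrderCharacter.𝒪 χ ⟦T⟧)
specialise {p} p-prime χ h i =
  evaluateAt p-prime (ℤ[ζ] p n) n character (γ₂ p) (λ j → ι p n (h i j))
  where open FiniteOrderCharacter χ

{-# OPTIONS --safe #-}

-- Take ψ of order p^n, n ≥ 1, so that 𝒪_ψ = ℤ_p[ζ], and put N = p^(n-1) (p - 1).
-- As Φ_{p^n}(X) ≡ (X - 1)^N mod p, evaluation at T₂ = ζ - 1 identifies 𝒪_ψ / p with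
-- 𝔽_p[T₂] / T₂^N.  The quotients of L by g over the various 𝒪_ψ, reduced mod p and lifted
-- to ℤ_p[[T₁,T₂]], are solutions s of  s g ≡ L mod (p, T₂^N).  Since g(T₁,0) ≢ 0 mod p, such
-- an s is unique mod (p, T₂^N); hence the lifts agree and glue, as N → ∞, to one s with
-- s g ≡ L mod p.  The series (L - s g) / p again satisfies the hypothesis, the rings 𝒪_ψ having
-- no p-torsion.  Iterating, the quotient is  q = s₀ + p s₁ + p² s₂ + ...
module Submission where

open import Algebra.Bundles using (CommutativeRing)
import Algebra.Morphism.Construct.Composition as Composition
open import Algebra.Morphism.Structures using (module RingMorphisms)
import Algebra.Properties.Ring as RingProperties
open import Data.Fin.Base using (Fin; zero; suc; toℕ)
open import Data.Integer.Base as ℤ using (ℤ; +_; ∣_∣)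
open import Data.Integer.DivMod using (_%ℕ_; _/ℕ_; a≡a%ℕn+[a/ℕn]*n)
import Data.Integer.Divisibility.Signed as ℤ∣
import Data.Integer.Properties as ℤₚ
open import Data.Nat.Base as ℕ using (ℕ; zero; suc; _≤_; _<_; z≤n; s≤s; _∸_)
open import Data.Nat.Coprimality using (Coprime; coprime-Bézout)
import Data.Nat.Divisibility as ℕ∣
open import Data.Nat.GCD using (module Bézout)
open import Data.Nat.Primality using (Prime; prime⇒nonZero; euclidsLemma; prime⇒nonTrivial; prime⇒irreducible)
import Data.Nat.Properties as ℕₚ
open import Data.Product.Base using (_,_; _×_; ∃; Σ; proj₁; proj₂; ∃₂)
import Data.Sum.Base as Sum
open import Data.Sum.Base using (_⊎_; inj₁; inj₂)
open import Defs
open import Function.Base using (_∘_; _⟨_⟩_)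
open import Level using (Level; _⊔_)
open import Relation.Binary.PropositionalEquality as ≡ using (_≡_; _≢_)
open import Relation.Nullary.Decidable using (Dec; yes; no; map′)
open import Relation.Nullary.Negation using (¬_; contradiction)
open import Relation.Unary using (_⊆_)

-- The quotients over the various 𝒪_ψ lie in different rings, so they cannot be compared as they
-- stand. Only modulo p do they become truncations of series over 𝔽_p in the single variable T₂, and
-- there they can be glued; this is why the quotient is built one p-adic digit at a time. Uniqueness
-- of a digit rests on 𝔽_p[[T₁]] being a domain: as g(T₁,0) is nonzero there, induction on the power
-- of T₂ makes g cancellable modulo (p, T₂^N) for every N. The hypothesis on g is a negation and
-- exhibits no nonzero coefficient, so cancellation works from decidability of divisibility by p
-- instead. The facts about 𝒪_ψ are settled before completion, in ℤ[ζ] = ℤ[X]/Φ, because a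
-- completion and the ring it comes from have the same reduction modulo p. There they become
-- statements about T = X - 1 in 𝔽_p[X]. The number N is the degree of Φ; it grows with n, so every
-- power of T₂ is eventually seen.

module _ {c ℓ c′ ℓ′ : Level} (R : CommutativeRing c ℓ) (S : CommutativeRing c′ ℓ′) where
  private
    module R = RingNotation R
    module S = RingNotation S

  Homomorphism : (R.Carrier → S.Carrier) → Set (c ⊔ ℓ ⊔ ℓ′)
  Homomorphism = RingMorphisms.IsRingHomomorphism R.rawRing S.rawRing

  homomorphism : {φ : R.Carrier → S.Carrier} →
    (∀ {x y} → x R.≈ y → φ x S.≈ φ y) →
    (∀ x y → φ (x R.+ y) S.≈ φ x S.+ φ y) →
    (∀ x y → φ (x R.* y) S.≈ φ x S.* φ y) →
    φ R.1# S.≈ S.1# → Homomorphism φ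
  homomorphism {φ} cong +-homo *-homo 1#-homo = record
    { isSemiringHomomorphism = record
      { isNearSemiringHomomorphism = record
        { +-isMonoidHomomorphism = record
          { isMagmaHomomorphism = record { isRelHomomorphism = record { cong = cong } ; homo = +-homo }
          ; ε-homo = 0#-homo
          }
        ; *-homo = *-homo
        }
      ; 1#-homo = 1#-homo
      }
    ; -‿homo = λ x → +-inverseʳ-unique (φ x) (φ (R.- x))
        (S.trans (S.sym (+-homo x (R.- x))) (S.trans (cong (R.-‿inverseʳ x)) 0#-homo))
    }
    where
    open RingProperties S.ring using (+-identityˡ-unique; +-inverseʳ-unique)
    0#-homo : φ R.0# S.≈ S.0#
    0#-homo = +-identityˡ-unique (φ R.0#) (φ R.0#)
      (S.trans (S.sym (+-homo R.0# R.0#)) (cong (R.+-identityˡ R.0#)))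

-- Ring homomorphisms on sums, powers and power series.

module HomomorphismProperties {c ℓ c′ ℓ′ : Level}
  (R : CommutativeRing c ℓ) (S : CommutativeRing c′ ℓ′)
  {φ : CommutativeRing.Carrier R → CommutativeRing.Carrier S} (φ-hom : Homomorphism R S φ) where
  private
    module R = RingNotation R
    module S = RingNotation S
  open RingMorphisms.IsRingHomomorphism φ-hom public

  sum-homo : ∀ {n} (f : Fin n → R.Carrier) → φ (R.sum f) S.≈ S.sum (φ ∘ f)
  sum-homo {zero}  f = 0#-homo
  sum-homo {suc n} f = S.trans (+-homo _ _) (S.+-congˡ (sum-homo (f ∘ suc)))

  nat-homo : ∀ n → φ (R.nat n) S.≈ S.nat n
  nat-homo zero    = 0#-homo
  nat-homo (suc n) = S.trans (+-homo _ _) (S.+-cong 1#-homo (nat-homo n))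

  ^-homo : ∀ x n → φ (x R.^ n) S.≈ φ x S.^ n
  ^-homo x zero    = 1#-homo
  ^-homo x (suc n) = S.trans (*-homo _ _) (S.*-congˡ (^-homo x n))

  minus-homo : ∀ x y → φ (x R.- y) S.≈ φ x S.- φ y
  minus-homo x y = S.trans (+-homo _ _) (S.+-congˡ (-‿homo y))

  ∣-homo : ∀ {x y} → x R.∣ y → φ x S.∣ φ y
  ∣-homo (q R., e) = φ q S., S.trans (S.sym (*-homo _ _)) (⟦⟧-cong e)

  cauchy-homo : ∀ f g n → φ (cauchy R f g n) S.≈ cauchy S (φ ∘ f) (φ ∘ g) n
  cauchy-homo f g n = S.trans (sum-homo {suc n} λ i → f (toℕ i) R.* g (n ∸ toℕ i))
    (sum-cong-≋ {suc n} λ i → *-homo (f (toℕ i)) (g (n ∸ toℕ i)))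
    where
    open import Algebra.Properties.CommutativeMonoid.Sum S.+-commutativeMonoid using (sum-cong-≋)

  series-homomorphism : Homomorphism (R ⟦T⟧) (S ⟦T⟧) (φ ∘_)
  series-homomorphism = homomorphism (R ⟦T⟧) (S ⟦T⟧)
    (λ e → coefficientwise λ n → ⟦⟧-cong (SeriesEq.at e n))
    (λ f g → coefficientwise λ n → +-homo (f n) (g n))
    (λ f g → coefficientwise (cauchy-homo f g))
    (coefficientwise λ { zero → 1#-homo ; (suc _) → 0#-homo })

-- Divisibility, congruences and cancellation of power series factors.

module _ {c ℓ : Level} (R : CommutativeRing c ℓ) where
  open RingNotation R
  open RingProperties ring
  open import Relation.Binary.Reasoning.Setoid setoid

  x-y≈0⇒x≈y : ∀ {x y} → x - y ≈ 0# → x ≈ y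
  x-y≈0⇒x≈y = x∙y⁻¹≈ε⇒x≈y _ _

  x≈y⇒x-y≈0 : ∀ {x y} → x ≈ y → x - y ≈ 0#
  x≈y⇒x-y≈0 = x≈y⇒x∙y⁻¹≈ε

  x≈y+[x-y] : ∀ x y → x ≈ y + (x - y)
  x≈y+[x-y] x y = sym (trans (+-comm _ _) (trans (+-assoc _ _ _)
    (trans (+-congˡ (-‿inverseˡ y)) (+-identityʳ x))))

  x≈y+z⇒x-y≈z : ∀ {x y z} → x ≈ y + z → x - y ≈ z
  x≈y+z⇒x-y≈z {x} {y} {z} e = begin
    x - y         ≈⟨ +-congʳ (trans e (+-comm y z)) ⟩
    z + y - y     ≈⟨ +-assoc z y (- y) ⟩
    z + (y - y)   ≈⟨ +-congˡ (-‿inverseʳ y) ⟩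
    z + 0#        ≈⟨ +-identityʳ z ⟩
    z             ∎

  ∣-respˡ : ∀ {a b x} → a ≈ b → a ∣ x → b ∣ x
  ∣-respˡ e (q , qa≈x) = q , trans (*-congˡ (sym e)) qa≈x

  ∣-respʳ : ∀ {a x y} → x ≈ y → a ∣ x → a ∣ y
  ∣-respʳ e (q , qa≈x) = q , trans qa≈x e

  ∣-* : ∀ {a x} y → a ∣ x → a ∣ y * x
  ∣-* {a} {x} y (q , qa≈x) = y * q , trans (*-assoc y q a) (*-congˡ qa≈x)

  ∣-transitive : ∀ {a b x} → a ∣ b → b ∣ x → a ∣ x
  ∣-transitive (q , qa≈b) (r , rb≈x) = ∣-respʳ rb≈x (∣-* r (q , qa≈b))

  ∣-+ : ∀ {a x y} → a ∣ x → a ∣ y → a ∣ x + y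
  ∣-+ {a} (q , e) (r , e′) = q + r , trans (distribʳ a q r) (+-cong e e′)

  ∣-neg : ∀ {a x} → a ∣ x → a ∣ - x
  ∣-neg {a} (q , e) = - q , trans (sym (-‿distribˡ-* q a)) (-‿cong e)

  ∣-cancelʳ : ∀ {a x y} → a ∣ x + y → a ∣ y → a ∣ x
  ∣-cancelʳ a∣x+y a∣y = ∣-respʳ
    (trans (+-assoc _ _ _) (trans (+-congˡ (-‿inverseʳ _)) (+-identityʳ _)))
    (∣-+ a∣x+y (∣-neg a∣y))

  nat-* : ∀ m x → nat m * x ≈ m · x
  nat-* m x = trans (×-assoc-* m 1# x) (×-congʳ m (*-identityˡ x))
    where open import Algebra.Properties.Semiring.Mult semiring using (×-assoc-*; ×-congʳ)

  module _ (a : Carrier) where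
    private module Q = RingNotation (Quotient R a)

    quotient-homomorphism : Homomorphism R (Quotient R a) (λ x → x)
    quotient-homomorphism = homomorphism R (Quotient R a) (≈⇒≡mod R a)
      (λ _ _ → Q.refl) (λ _ _ → Q.refl) Q.refl

    ∣⇒≡mod : ∀ {x y} → a ∣ x - y → x Q.≈ y
    ∣⇒≡mod = congruent

    ≡mod⇒∣ : ∀ {x y} → x Q.≈ y → a ∣ x - y
    ≡mod⇒∣ = CongruentMod.divides-difference

    ≡mod⇒+ : ∀ {x y} → x Q.≈ y → ∃ λ d → x ≈ y + d * a
    ≡mod⇒+ {x} {y} (congruent (d , e)) = d , trans (x≈y+[x-y] x y) (+-congˡ (sym e))

    a≡0 : a Q.≈ 0#
    a≡0 = ∣⇒≡0mod R a (1# , *-identityˡ a)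

  cauchy-tail : ∀ f g → f 0 ≈ 0# → (∀ n → cauchy R f g n ≈ 0#) → ∀ n → cauchy R (λ i → f (suc i)) g n ≈ 0#
  cauchy-tail f g f₀≈0 fg≈0 n = begin
    cauchy R (λ i → f (suc i)) g n                     ≈⟨ +-identityˡ _ ⟨
    0# + cauchy R (λ i → f (suc i)) g n                ≈⟨ +-congʳ (trans (*-congʳ f₀≈0) (zeroˡ _)) ⟨
    f 0 * g (suc n) + cauchy R (λ i → f (suc i)) g n   ≈⟨ fg≈0 (suc n) ⟩
    0#                                                 ∎

  private module T = CommutativeRing (R ⟦T⟧)

  cauchy-comm : ∀ f g n → cauchy R f g n ≈ cauchy R g f n
  cauchy-comm f g = SeriesEq.at (T.*-comm f g)

  cauchy-zeroˡ : ∀ f g → (∀ i → f i ≈ 0#) → ∀ n → cauchy R f g n ≈ 0#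
  cauchy-zeroˡ f g f≈0 n = SeriesEq.at (T.trans (T.*-congʳ {g} {f} {λ _ → 0#} (coefficientwise f≈0)) (T.zeroˡ g)) n

  cauchy-scale : ∀ a f g n → cauchy R (λ i → a * f i) g n ≈ a * cauchy R f g n
  cauchy-scale a f g n = trans
    (sum-cong-≋ {suc n} λ i → *-assoc a (f (toℕ i)) (g (n ∸ toℕ i)))
    (sym (*-distribˡ-sum {suc n} a (λ i → f (toℕ i) * g (n ∸ toℕ i))))
    where
    open import Algebra.Properties.Semiring.Sum semiring using (sum-cong-≋; *-distribˡ-sum)

  cauchy-constantˡ : ∀ a f n → cauchy R (constant R a) f n ≈ a * f n
  cauchy-constantˡ a f zero    = +-identityʳ _
  cauchy-constantˡ a f (suc n) =
    trans (+-congˡ (cauchy-zeroˡ (λ i → constant R a (suc i)) f (λ _ → refl) n)) (+-identityʳ _)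

  module _ (domain : ∀ x y → x * y ≈ 0# → x ≈ 0# ⊎ y ≈ 0#) where

    -- Constant terms give `f 0 ≈ 0#`, since `g 0` cancels in a domain. Then `f` is T times its
    -- tail, and the product of the tail with `g` vanishes as well.
    cauchy-cancel-invertible : ∀ f g → ¬ g 0 ≈ 0# → (∀ n → cauchy R f g n ≈ 0#) → ∀ i → f i ≈ 0#
    cauchy-cancel-invertible f g g₀≉0 fg≈0 = go
      where
      f₀≈0 : f 0 ≈ 0#
      f₀≈0 with domain (f 0) (g 0) (trans (sym (+-identityʳ _)) (fg≈0 0))
      ... | inj₁ f₀≈0 = f₀≈0
      ... | inj₂ g₀≈0 = contradiction g₀≈0 g₀≉0
      go : ∀ i → f i ≈ 0#
      go zero    = f₀≈0
      go (suc i) = cauchy-cancel-invertible (λ i → f (suc i)) g g₀≉0 (cauchy-tail f g f₀≈0 fg≈0) i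

    -- No nonzero coefficient of `g` is at hand, so the roles are exchanged: were `f 0` nonzero, `f`
    -- itself could be cancelled and all of `g` would vanish.
    cauchy-cancel : (∀ x → Dec (x ≈ 0#)) →
      ∀ f g → ¬ (∀ i → g i ≈ 0#) → (∀ n → cauchy R f g n ≈ 0#) → ∀ i → f i ≈ 0#
    cauchy-cancel 0? f g g≉0 fg≈0 = go
      where
      f₀≈0 : f 0 ≈ 0#
      f₀≈0 with 0? (f 0)
      ... | yes f₀≈0 = f₀≈0
      ... | no  f₀≉0 = contradiction
        (cauchy-cancel-invertible g f f₀≉0 λ n → trans (cauchy-comm g f n) (fg≈0 n)) g≉0
      go : ∀ i → f i ≈ 0#
      go zero    = f₀≈0
      go (suc i) = cauchy-cancel 0? (λ i → f (suc i)) g g≉0 (cauchy-tail f g f₀≈0 fg≈0) i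

module _ {c ℓ : Level} (F : CommutativeRing c ℓ) where
  open RingNotation F
  private module F⟦T⟧ = RingNotation (F ⟦T⟧)
  open import Algebra.Properties.CommutativeMonoid.Sum +-commutativeMonoid using (sum-cong-≋)

  constant-term-homomorphism : Homomorphism (F ⟦T⟧) F (λ f → f 0)
  constant-term-homomorphism = homomorphism (F ⟦T⟧) F (λ e → SeriesEq.at e 0)
    (λ _ _ → refl) (λ f g → +-identityʳ _) refl

  sum-coefficient : ∀ {n} (f : Fin n → Series F) j → F⟦T⟧.sum f j ≈ sum (λ i → f i j)
  sum-coefficient {zero}  f j = refl
  sum-coefficient {suc n} f j = +-congˡ (sum-coefficient (f ∘ suc) j)

  module _ (domain : ∀ x y → x * y ≈ 0# → x ≈ 0# ⊎ y ≈ 0#) (0? : ∀ x → Dec (x ≈ 0#)) where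

    -- The outer index belongs to T₁, the inner one to T₂. At T₂ = 0 the product becomes d(T₁,0)
    -- g(T₁,0), so d(T₁,0) = 0. Hence `d` is T₂ times `d′`, and `d′` times `g` vanishes to one order
    -- less.
    cauchy-cancel-truncated : ∀ (g : ℕ → Series F) → ¬ (∀ i → g i 0 ≈ 0#) →
      ∀ N (d : ℕ → Series F) →
      (∀ i j → j < N → cauchy (F ⟦T⟧) d g i j ≈ 0#) → ∀ i j → j < N → d i j ≈ 0#
    cauchy-cancel-truncated g g≉0 (suc N) d dg≈0 = go
      where
      d₀≈0 : ∀ i → d i 0 ≈ 0#
      d₀≈0 = cauchy-cancel F domain 0? (λ i → d i 0) (λ i → g i 0) g≉0 λ n →
        trans (sym (HomomorphismProperties.cauchy-homo (F ⟦T⟧) F constant-term-homomorphism d g n))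
              (dg≈0 n 0 (s≤s z≤n))
      d′ : ℕ → Series F
      d′ i j = d i (suc j)
      term : ∀ n → Fin (suc n) → Series F
      term n i = cauchy F (d (toℕ i)) (g (n ∸ toℕ i))
      term′ : ∀ n → Fin (suc n) → Series F
      term′ n i = cauchy F (d′ (toℕ i)) (g (n ∸ toℕ i))
      d′g≈0 : ∀ i j → j < N → cauchy (F ⟦T⟧) d′ g i j ≈ 0#
      d′g≈0 n j j<N = trans (sum-coefficient {suc n} (term′ n) j) (trans
        (sum-cong-≋ {suc n} {λ i → term′ n i j} {λ i → term n i (suc j)} λ i →
          sym (trans (+-congʳ (trans (*-congʳ (d₀≈0 (toℕ i))) (zeroˡ _))) (+-identityˡ _)))
        (trans (sym (sum-coefficient {suc n} (term n) (suc j))) (dg≈0 n (suc j) (s≤s j<N))))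
      go : ∀ i j → j < suc N → d i j ≈ 0#
      go i zero    _         = d₀≈0 i
      go i (suc j) (s≤s j<N) = cauchy-cancel-truncated g g≉0 N d′ d′g≈0 i j j<N

-- Descent of divisibility from specialisations of T₂.

record Specialisation {c ℓ c′ ℓ′ : Level} (B : CommutativeRing c ℓ) (O : CommutativeRing c′ ℓ′)
  (ϖ : CommutativeRing.Carrier B) (π : CommutativeRing.Carrier O) (N : ℕ) : Set (c ⊔ ℓ ⊔ c′ ⊔ ℓ′) where
  private
    module B = RingNotation B
    module O = RingNotation O
  field
    ev              : Series B → O.Carrier
    ev-homomorphism : Homomorphism (B ⟦T⟧) O ev
    -- This field and the next allow an equation between values of `ev` to be divided by `π`.
    ev-scale        : ∀ b → ev (λ j → ϖ B.* b j) O.≈ π O.* ev b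
    torsion-free    : ∀ x → π O.* x O.≈ O.0# → x O.≈ O.0#
    -- With the two fields below: `ev` induces an isomorphism from B[[T]] / (ϖ, T^N) onto O / π.
    injective-mod   : ∀ b → π O.∣ ev b → ∀ j → j < N → ϖ B.∣ b j
    vanishing-mod   : ∀ b → (∀ j → j < N → ϖ B.∣ b j) → π O.∣ ev b
    surjective-mod  : ∀ x → ∃ λ b → CongruentMod O π x (ev b)

module _ {c ℓ c′ ℓ′ : Level} (B : CommutativeRing c ℓ) (ϖ : CommutativeRing.Carrier B) where
  private module B = RingNotation B

  module Descent (ϖ-prime : ∀ x y → ϖ B.∣ x B.* y → ϖ B.∣ x ⊎ ϖ B.∣ y)
    (ϖ∣? : ∀ x → Dec (ϖ B.∣ x))
    (O : ℕ → CommutativeRing c′ ℓ′) (π : ∀ n → CommutativeRing.Carrier (O n)) (N : ℕ → ℕ)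
    (spec : ∀ n → Specialisation B (O n) ϖ (π n) (N n))
    (unbounded : ∀ j → ∃ λ n → j < N n)
    (g : Series (B ⟦T⟧)) (ϖ∤g[T₁,0] : ¬ (∀ i → ϖ B.∣ g i 0)) where

    private
      module Λ₂ = RingNotation (B ⟦T⟧)
      module S (n : ℕ) = Specialisation (spec n)
      module E (n : ℕ) = RingMorphisms.IsRingHomomorphism (S.ev-homomorphism n)
      module EP (n : ℕ) = HomomorphismProperties (B ⟦T⟧) (O n) (S.ev-homomorphism n)
      module O (n : ℕ) = RingNotation (O n)
      F : CommutativeRing _ _
      F = Quotient B ϖ
      module F = RingNotation F

    F-domain : ∀ x y → x F.* y F.≈ F.0# → x F.≈ F.0# ⊎ y F.≈ F.0#
    F-domain x y e = Sum.map (∣⇒≡0mod B ϖ) (∣⇒≡0mod B ϖ) (ϖ-prime x y (≡0mod⇒∣ B ϖ e))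

    F-0? : ∀ x → Dec (x F.≈ F.0#)
    F-0? x = map′ (∣⇒≡0mod B ϖ) (≡0mod⇒∣ B ϖ) (ϖ∣? x)

    record DividesSpecialisations (L : Series (B ⟦T⟧)) : Set (c ⊔ ℓ ⊔ c′ ⊔ ℓ′) where
      field
        quotient : ∀ n → Series (O n)
        equality : ∀ n i → cauchy (O n) (quotient n) (S.ev n ∘ g) i ⟨ O._≈_ n ⟩ S.ev n (L i)

    module _ (L : Series (B ⟦T⟧)) (D : DividesSpecialisations L) where
      open DividesSpecialisations D

      module _ (n : ℕ) where
        private
          module On = RingNotation (O n)
          module Dn = RingNotation (Quotient (O n) (π n))
          module Sn = Specialisation (spec n)
          D⟦T⟧ : CommutativeRing _ _
          D⟦T⟧ = Quotient (O n) (π n) ⟦T⟧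
          module D⟦T⟧ = CommutativeRing D⟦T⟧

        -- Modulo `π`, `quotient n` may be replaced by the specialisation of any `t` congruent to
        -- it. This serves twice: for the separate lifts `b n` and for the glued series `s`.
        divides-error : (t : ℕ → Series B) → (∀ i → quotient n i Dn.≈ Sn.ev (t i)) →
          ∀ i → π n On.∣ Sn.ev (L i Λ₂.- cauchy (B ⟦T⟧) t g i)
        divides-error t Q~t i = ∣-respʳ (O n) (On.sym (EP.minus-homo n _ _))
          (≡mod⇒∣ (O n) (π n) (begin
            Sn.ev (L i)
              ≈⟨ ≈⇒≡mod (O n) (π n) (equality n i) ⟨
            cauchy (O n) (quotient n) (Sn.ev ∘ g) i
              ≈⟨ SeriesEq.at (D⟦T⟧.*-congʳ {Sn.ev ∘ g} {quotient n} {Sn.ev ∘ t} (coefficientwise Q~t)) i ⟩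
            cauchy (O n) (Sn.ev ∘ t) (Sn.ev ∘ g) i
              ≈⟨ ≈⇒≡mod (O n) (π n) (EP.cauchy-homo n t g i) ⟨
            Sn.ev (cauchy (B ⟦T⟧) t g i)                    ∎))
          where open import Relation.Binary.Reasoning.Setoid Dn.setoid

      private
        b : ℕ → ℕ → Series B
        b n i = proj₁ (S.surjective-mod n (quotient n i))

        Q~b : ∀ n i → CongruentMod (O n) (π n) (quotient n i) (S.ev n (b n i))
        Q~b n i = proj₂ (S.surjective-mod n (quotient n i))

        L~bg : ∀ n i j → j < N n → L i j F.≈ cauchy (B ⟦T⟧) (b n) g i j
        L~bg n i j j<N = ∣⇒≡mod B ϖ (S.injective-mod n _ (divides-error n (b n) (Q~b n) i) j j<N)

        -- Up to T₂-degree `j` both lifts multiply `g` to `L` modulo `ϖ`. Their difference therefore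
        -- annihilates `g` modulo (ϖ, T₂^(j+1)), and `g` cancels.
        b-unique : ∀ n n′ i j → j < N n → j < N n′ → ϖ B.∣ b n i j B.- b n′ i j
        b-unique n n′ i j j<N j<N′ = ≡0mod⇒∣ B ϖ
          (cauchy-cancel-truncated F F-domain F-0? g (λ e → ϖ∤g[T₁,0] λ i → ≡0mod⇒∣ B ϖ (e i))
            (suc j) (λ i j → b n i j B.- b n′ i j)
            (λ { i k (s≤s k≤j) → F.trans
              (SeriesEq.at (SeriesEq.at ([y-z]x≈yx-zx g (b n) (b n′)) i) k)
              (x≈y⇒x-y≈0 F (F.trans (F.sym (L~bg n i k (ℕₚ.≤-<-trans k≤j j<N)))
                                    (L~bg n′ i k (ℕₚ.≤-<-trans k≤j j<N′)))) })
            i j ℕₚ.≤-refl)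
          where open RingProperties (CommutativeRing.ring ((F ⟦T⟧) ⟦T⟧)) using ([y-z]x≈yx-zx)

        -- The gluing: the T₂^j coefficient is read at a level whose truncation order exceeds `j`.
        -- By `b-unique` the choice of level is immaterial modulo `ϖ`.
        s : Series (B ⟦T⟧)
        s i j = b (proj₁ (unbounded j)) i j

        b~s : ∀ n i → CongruentMod (O n) (π n) (S.ev n (b n i)) (S.ev n (s i))
        b~s n i = ∣⇒≡mod (O n) (π n) (∣-respʳ (O n) (EP.minus-homo n (b n i) (s i))
          (S.vanishing-mod n (b n i Λ₂.- s i) λ j j<N →
            b-unique n (proj₁ (unbounded j)) i j j<N (proj₂ (unbounded j))))

        Q~s : ∀ n i → CongruentMod (O n) (π n) (quotient n i) (S.ev n (s i))
        Q~s n i = CommutativeRing.trans (Quotient (O n) (π n)) (Q~b n i) (b~s n i)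

        sg : Series (B ⟦T⟧)
        sg = cauchy (B ⟦T⟧) s g

        -- A level `n` controls only the T₂-degrees below `N n`, so each `j` is tested at the level
        -- that `unbounded` assigns to it.
        L≡sg : ∀ i j → L i j F.≈ sg i j
        L≡sg i j = ∣⇒≡mod B ϖ (S.injective-mod n _ (divides-error n s (Q~s n) i) j (proj₂ (unbounded j)))
          where
          n : ℕ
          n = proj₁ (unbounded j)

        L′ : Series (B ⟦T⟧)
        L′ i j = proj₁ (≡mod⇒+ B ϖ (L≡sg i j))

        L≈sg+ϖL′ : ∀ i j → L i j B.≈ sg i j B.+ ϖ B.* L′ i j
        L≈sg+ϖL′ i j = B.trans (proj₂ (≡mod⇒+ B ϖ (L≡sg i j))) (B.+-congˡ (B.*-comm _ _))

        Q′ : ∀ n → Series (O n)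
        Q′ n i = proj₁ (≡mod⇒+ (O n) (π n) (Q~s n i))

        -- After multiplication by `π` and addition of `ev (sg i)` both sides equal `ev (L i)`: one
        -- by expanding the quotient as `ev s + π Q′`, the other by expanding `L` as `sg + ϖ L′`.
        -- Then `π` cancels by torsion-freeness.
        Q′g≈L′ : ∀ n i → cauchy (O n) (Q′ n) (S.ev n ∘ g) i ⟨ O._≈_ n ⟩ S.ev n (L′ i)
        Q′g≈L′ n i = x-y≈0⇒x≈y (O n) (S.torsion-free n _ (begin
          π n * (x - y)                  ≈⟨ x[y-z]≈xy-xz (π n) x y ⟩
          π n * x - π n * y              ≈⟨ x≈y⇒x-y≈0 (O n) (+-cancelˡ (ev (sg i)) (π n * x) (π n * y) (begin
              ev (sg i) + π n * x        ≈⟨ via-Q ⟨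
              ev (L i)                   ≈⟨ E.⟦⟧-cong n (coefficientwise (L≈sg+ϖL′ i)) ⟩
              ev (sg i Λ₂.+ (λ j → ϖ B.* L′ i j))  ≈⟨ E.+-homo n (sg i) (λ j → ϖ B.* L′ i j) ⟩
              ev (sg i) + ev (λ j → ϖ B.* L′ i j)  ≈⟨ +-congˡ (S.ev-scale n (L′ i)) ⟩
              ev (sg i) + π n * y        ∎)) ⟩
          0#                             ∎))
          where
          open RingNotation (O n)
          open RingProperties ring using (+-cancelˡ; x[y-z]≈xy-xz)
          open import Relation.Binary.Reasoning.Setoid setoid
          module O⟦T⟧ = CommutativeRing (O n ⟦T⟧)
          ev : Series B → Carrier
          ev = S.ev n
          x y : Carrier
          x = cauchy (O n) (Q′ n) (ev ∘ g) i
          y = ev (L′ i)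
          πQ′ : Series (O n)
          πQ′ i = π n * Q′ n i
          via-Q : ev (L i) ≈ ev (sg i) + π n * x
          via-Q = begin
            ev (L i)                                          ≈⟨ equality n i ⟨
            cauchy (O n) (quotient n) (ev ∘ g) i
              ≈⟨ SeriesEq.at (O⟦T⟧.*-congʳ {ev ∘ g} {quotient n} {λ i → ev (s i) + πQ′ i}
                   (coefficientwise λ i → trans (proj₂ (≡mod⇒+ (O n) (π n) (Q~s n i))) (+-congˡ (*-comm _ _)))) i ⟩
            cauchy (O n) (λ i → ev (s i) + πQ′ i) (ev ∘ g) i
              ≈⟨ SeriesEq.at (O⟦T⟧.distribʳ (ev ∘ g) (ev ∘ s) πQ′) i ⟩
            cauchy (O n) (ev ∘ s) (ev ∘ g) i + cauchy (O n) πQ′ (ev ∘ g) i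
              ≈⟨ +-cong (sym (EP.cauchy-homo n s g i)) (cauchy-scale (O n) (π n) (Q′ n) (ev ∘ g) i) ⟩
            ev (sg i) + π n * x                               ∎

      step : ∃ λ s → Σ (Series (B ⟦T⟧)) λ L′ → DividesSpecialisations L′ ×
        (∀ i j → L i j B.≈ cauchy (B ⟦T⟧) s g i j B.+ ϖ B.* L′ i j)
      step = s , L′ , record { quotient = Q′ ; equality = Q′g≈L′ } , L≈sg+ϖL′

    module _ (complete : ∀ (s : ℕ → B.Carrier) → Σ (ℕ → B.Carrier) λ q → ∀ k → q k B.≈ s k B.+ ϖ B.* q (suc k))
             (separated : ∀ (e : ℕ → B.Carrier) → (∀ k → e k B.≈ ϖ B.* e (suc k)) → e 0 B.≈ B.0#)
      where
      private module Λ = RingNotation ((B ⟦T⟧) ⟦T⟧)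

      -- With q_k standing for the tail s_k + ϖ s_(k+1) + ..., the errors e_k = L_k - q_k g satisfy
      -- e_k = ϖ e_(k+1), so e_0 = 0 by separatedness. Working with tails, characterised by their
      -- recursion, avoids multiplying a limit by `g`.
      divides-of-specialisations : ∀ L → DividesSpecialisations L → g Λ.∣ L
      divides-of-specialisations L D = q 0 Λ., coefficientwise λ i → coefficientwise λ j →
        B.sym (x-y≈0⇒x≈y B (separated (λ k → Ls k i j B.- cauchy (B ⟦T⟧) (q k) g i j) (error i j)))
        where
        state : ℕ → Σ (Series (B ⟦T⟧)) DividesSpecialisations
        state zero    = L , D
        state (suc k) = let s , L′ , D′ , _ = step (proj₁ (state k)) (proj₂ (state k)) in L′ , D′
        Ls : ℕ → Series (B ⟦T⟧)
        Ls k = proj₁ (state k)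
        s : ℕ → Series (B ⟦T⟧)
        s k = proj₁ (step (Ls k) (proj₂ (state k)))
        L≈ : ∀ k i j → Ls k i j B.≈ cauchy (B ⟦T⟧) (s k) g i j B.+ ϖ B.* Ls (suc k) i j
        L≈ k = proj₂ (proj₂ (proj₂ (step (Ls k) (proj₂ (state k)))))
        q : ℕ → Series (B ⟦T⟧)
        q k i j = proj₁ (complete (λ k → s k i j)) k
        q≈ : ∀ k i j → q k i j B.≈ s k i j B.+ ϖ B.* q (suc k) i j
        q≈ k i j = proj₂ (complete (λ k → s k i j)) k

        error : ∀ i j k → Ls k i j B.- cauchy (B ⟦T⟧) (q k) g i j B.≈
                          ϖ B.* (Ls (suc k) i j B.- cauchy (B ⟦T⟧) (q (suc k)) g i j)
        error i j k = x≈y+z⇒x-y≈z B (begin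
            Ls k i j                                   ≈⟨ L≈ k i j ⟩
            sg + ϖ * L′                                ≈⟨ +-congˡ (*-congˡ (x≈y+[x-y] B L′ qg)) ⟩
            sg + ϖ * (qg + (L′ - qg))                  ≈⟨ +-congˡ (distribˡ _ _ _) ⟩
            sg + (ϖ * qg + ϖ * (L′ - qg))              ≈⟨ +-assoc _ _ _ ⟨
            sg + ϖ * qg + ϖ * (L′ - qg)                ≈⟨ +-congʳ qg≈ ⟨
            cauchy (B ⟦T⟧) (q k) g i j + ϖ * (L′ - qg) ∎)
          where
          open RingNotation B
          open import Relation.Binary.Reasoning.Setoid setoid
          sg L′ qg : Carrier
          sg = cauchy (B ⟦T⟧) (s k) g i j
          L′ = Ls (suc k) i j
          qg = cauchy (B ⟦T⟧) (q (suc k)) g i j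
          -- `cauchy-scale` over B⟦T⟧ takes scalars from B⟦T⟧, so `ϖ` enters as a constant series.
          ϖ′ : Series B
          ϖ′ = constant B ϖ
          qg≈ : cauchy (B ⟦T⟧) (q k) g i j ≈ sg + ϖ * qg
          qg≈ = begin
            cauchy (B ⟦T⟧) (q k) g i j
              ≈⟨ SeriesEq.at (SeriesEq.at (Λ.*-congʳ {g} {q k} {λ i j → s k i j + cauchy B ϖ′ (q (suc k) i) j}
                   (coefficientwise λ i → coefficientwise λ j → trans (q≈ k i j)
                     (+-congˡ (sym (cauchy-constantˡ B ϖ (q (suc k) i) j))))) i) j ⟩
            cauchy (B ⟦T⟧) (λ i j → s k i j + cauchy B ϖ′ (q (suc k) i) j) g i j
              ≈⟨ SeriesEq.at (SeriesEq.at (Λ.distribʳ g (s k) (λ i → cauchy B ϖ′ (q (suc k) i))) i) j ⟩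
            sg + cauchy (B ⟦T⟧) (λ i → cauchy B ϖ′ (q (suc k) i)) g i j
              ≈⟨ +-congˡ (SeriesEq.at (cauchy-scale (B ⟦T⟧) ϖ′ (q (suc k)) g i) j) ⟩
            sg + cauchy B ϖ′ (cauchy (B ⟦T⟧) (q (suc k)) g i) j
              ≈⟨ +-congˡ (cauchy-constantˡ B ϖ (cauchy (B ⟦T⟧) (q (suc k)) g i) j) ⟩
            sg + ϖ * qg ∎

-- The p-adic completion: completeness, torsion and reduction modulo p.

module CompletionProperties {c ℓ : Level} (R : CommutativeRing c ℓ) (p : ℕ) where
  private
    module R = RingNotation R
    C : CommutativeRing _ _
    C = Completion R p
    module C = RingNotation C
    module Q (k : ℕ) = RingNotation (R/p^ R p k)
  open Compatible

  level-homomorphism : ∀ k → Homomorphism C (R/p^ R p k) (λ x → approx x k)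
  level-homomorphism k = homomorphism C (R/p^ R p k) (λ e → CompatibleEq.at-level e k)
    (λ _ _ → Q.refl k) (λ _ _ → Q.refl k) (Q.refl k)

  diagonal-homomorphism : Homomorphism R C (diagonal R p)
  diagonal-homomorphism = homomorphism R C (λ e → levelwise λ k → ≈⇒≡mod R _ e)
    (λ _ _ → levelwise λ k → Q.refl k) (λ _ _ → levelwise λ k → Q.refl k) C.refl

  approx-nat : ∀ n k → approx (C.nat n) k ≡ R.nat n
  approx-nat zero    k = ≡.refl
  approx-nat (suc n) k = ≡.cong (R.1# R.+_) (approx-nat n k)

  approx-^ : ∀ x n k → approx (x C.^ n) k ≡ approx x k R.^ n
  approx-^ x zero    k = ≡.refl
  approx-^ x (suc n) k = ≡.cong (approx x k R.*_) (approx-^ x n k)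

  p^∣⇒level≡0 : ∀ k {x} → C.nat p C.^ k C.∣ x → Q._≈_ k (approx x k) R.0#
  p^∣⇒level≡0 k {x} (q C., e) = Q.trans k (Q.sym k (CompatibleEq.at-level e k))
    (∣⇒≡0mod R (R.nat p R.^ k) (approx q k R., R.*-congˡ (R.reflexive (≡.sym
      (≡.trans (approx-^ (C.nat p) k k) (≡.cong (R._^ k) (approx-nat p k)))))))

  p∣⇒p∣level₁ : ∀ {x} → C.nat p C.∣ x → R.nat p R.∣ approx x 1
  p∣⇒p∣level₁ p∣x = ∣-respˡ R (R.*-identityʳ _) (≡0mod⇒∣ R _
    (p^∣⇒level≡0 1 (∣-respˡ C (C.sym (C.*-identityʳ _)) p∣x)))

  private
    -- The sum of p^i s(k+i) over i < m in Horner form, so that peeling off the first term moves `k`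
    -- to `suc k`.
    sums : (ℕ → C.Carrier) → ℕ → ℕ → C.Carrier
    sums s k zero    = C.0#
    sums s k (suc m) = s k C.+ C.nat p C.* sums s (suc k) m

    sums-cauchy : ∀ s m k → C.nat p C.^ m C.∣ (sums s k (suc m) C.- sums s k m)
    sums-cauchy s zero    k = _ C., C.*-identityʳ _
    sums-cauchy s (suc m) k with sums-cauchy s m (suc k)
    ... | d C., e = d C., (begin
      d * (nat p * nat p ^ m)                          ≈⟨ x∙yz≈y∙xz d (nat p) (nat p ^ m) ⟩
      nat p * (d * nat p ^ m)                          ≈⟨ *-congˡ e ⟩
      nat p * (a - b)                                  ≈⟨ x≈y+z⇒x-y≈z C sum-eq ⟨
      s k + nat p * a - (s k + nat p * b)              ∎)
      where
      open RingNotation C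
      open import Relation.Binary.Reasoning.Setoid setoid
      open import Algebra.Properties.CommutativeSemigroup *-commutativeSemigroup using (x∙yz≈y∙xz)
      a b : Carrier
      a = sums s (suc k) (suc m)
      b = sums s (suc k) m
      sum-eq : s k + nat p * a ≈ s k + nat p * b + nat p * (a - b)
      sum-eq = begin
        s k + nat p * a                            ≈⟨ +-congˡ (*-congˡ (x≈y+[x-y] C a b)) ⟩
        s k + nat p * (b + (a - b))                ≈⟨ +-congˡ (distribˡ _ _ _) ⟩
        s k + (nat p * b + nat p * (a - b))        ≈⟨ +-assoc _ _ _ ⟨
        s k + nat p * b + nat p * (a - b)          ∎

  complete : (s : ℕ → C.Carrier) → Σ (ℕ → C.Carrier) λ q → ∀ k → q k C.≈ s k C.+ C.nat p C.* q (suc k)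
  complete s = (λ k → limit R p (sums s k) (λ m → sums-cauchy s m k)) , λ k → levelwise λ m →
    -- At level `m` the left side is `sums s k m`, while the right side unfolds to
    -- `sums s k (suc m)`; their difference is divisible by p^m.
    Q.sym m (Q.trans m
      (≈⇒≡mod R _ (x≈y+[x-y] R (approx (sums s k (suc m)) m) (approx (sums s k m) m)))
      (Q.trans m (Q.+-congˡ m (p^∣⇒level≡0 m (sums-cauchy s m k))) (Q.+-identityʳ m _)))

  -- Unrolling the recursion k times writes `e 0` as a multiple of p^k, which vanishes at level k.
  separated : (e : ℕ → C.Carrier) → (∀ k → e k C.≈ C.nat p C.* e (suc k)) → e 0 C.≈ C.0#
  separated e e≈ = levelwise λ k → p^∣⇒level≡0 k (e (k ℕ.+ 0) C., C.sym (go k 0))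
    where
    open import Algebra.Properties.CommutativeSemigroup C.*-commutativeSemigroup using (x∙yz≈y∙xz)
    go : ∀ m k → e k C.≈ e (m ℕ.+ k) C.* C.nat p C.^ m
    go zero    k = C.sym (C.*-identityʳ _)
    go (suc m) k = C.trans (e≈ k) (C.trans (C.*-congˡ (go m (suc k))) (C.trans
      (x∙yz≈y∙xz _ _ _) (C.*-congʳ (C.reflexive (≡.cong e (ℕₚ.+-suc m k))))))

  module _ (torsion-free : ∀ x → R.nat p R.* x R.≈ R.0# → x R.≈ R.0#) where

    cancel-p : ∀ k {x y} → R.nat p R.* x R.≈ y → Q._≈_ (suc k) y R.0# → Q._≈_ k x R.0#
    cancel-p k {x} {y} px≈y y≡0 with ≡0mod⇒∣ R _ y≡0
    ... | q R., e = ∣⇒≡0mod R _ (q R., x-y≈0⇒x≈y R (torsion-free _ (begin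
      nat p * (q * nat p ^ k - x)            ≈⟨ x[y-z]≈xy-xz _ _ _ ⟩
      nat p * (q * nat p ^ k) - nat p * x    ≈⟨ x≈y⇒x-y≈0 R (begin
          nat p * (q * nat p ^ k)            ≈⟨ x∙yz≈y∙xz _ _ _ ⟩
          q * (nat p * nat p ^ k)            ≈⟨ e ⟩
          y                                  ≈⟨ px≈y ⟨
          nat p * x                          ∎) ⟩
      0#                                     ∎)))
      where
      open RingNotation R
      open RingProperties ring using (x[y-z]≈xy-xz)
      open import Relation.Binary.Reasoning.Setoid setoid
      open import Algebra.Properties.CommutativeSemigroup *-commutativeSemigroup using (x∙yz≈y∙xz)

    -- Dividing by p costs one level: x at level k is read off from p x at level k + 1.
    completion-torsion-free : ∀ x → C.nat p C.* x C.≈ C.0# → x C.≈ C.0#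
    completion-torsion-free x px≈0 = levelwise λ k → Q.trans k (Q.sym k (coherent x k))
      (cancel-p k (R.*-congʳ (R.reflexive (≡.sym (approx-nat p (suc k))))) (CompatibleEq.at-level px≈0 (suc k)))

    -- All higher approximations are congruent to the first modulo p, so each is divisible by p. The
    -- k-th approximation of the quotient is taken from level k + 1 of `x`, because coherence modulo
    -- p^k needs a congruence modulo p^(k+1) before division.
    p∣level₁⇒p∣ : ∀ {x} → R.nat p R.∣ approx x 1 → C.nat p C.∣ x
    p∣level₁⇒p∣ {x} p∣x₁ = compatible y coherent-y C., levelwise λ k → Q.trans k
      (≈⇒≡mod R _ (R.trans (R.*-congˡ (R.reflexive (approx-nat p k))) (proj₂ (p∣x k))))
      (coherent x k)
      where
      p∣x : ∀ k → ∃ λ y → y R.* R.nat p R.≈ approx x (suc k)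
      p∣x zero    = let (q R., e) = p∣x₁ in q , e
      p∣x (suc k) with p∣x k | ≡mod⇒+ R _ (coherent x (suc k))
      ... | y , yp≈x | d , e = y + d * nat p ^ k , (begin
        (y + d * nat p ^ k) * nat p             ≈⟨ distribʳ _ _ _ ⟩
        y * nat p + d * nat p ^ k * nat p       ≈⟨ +-cong yp≈x (trans (*-assoc _ _ _) (*-congˡ (*-comm _ _))) ⟩
        approx x (suc k) + d * (nat p * nat p ^ k)  ≈⟨ e ⟨
        approx x (suc (suc k))                  ∎)
        where
        open RingNotation R
        open import Relation.Binary.Reasoning.Setoid setoid
      y : ℕ → R.Carrier
      y k = proj₁ (p∣x k)
      coherent-y : ∀ k → Q._≈_ k (y (suc k)) (y k)
      coherent-y k = x-y≈0⇒x≈y (R/p^ R p k) (cancel-p k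
        (R.trans (x[y-z]≈xy-xz _ _ _) (R.+-cong (R.trans (R.*-comm _ _) (proj₂ (p∣x (suc k))))
          (R.-‿cong (R.trans (R.*-comm _ _) (proj₂ (p∣x k))))))
        (x≈y⇒x-y≈0 (R/p^ R p (suc k)) (coherent x (suc k))))
        where open RingProperties R.ring using (x[y-z]≈xy-xz)

    -- The difference is zero at level 1. Hence reduction modulo p can be computed in `R`.
    ≡mod-level₁ : ∀ x → CongruentMod C (C.nat p) x (diagonal R p (approx x 1))
    ≡mod-level₁ x = ∣⇒≡mod C _ (p∣level₁⇒p∣ (R.0# R., R.trans (R.zeroˡ _) (R.sym (R.-‿inverseʳ _))))

-- Truncated evaluation of power series.

module PartialSums {c ℓ : Level} (R : CommutativeRing c ℓ) where
  open RingNotation R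
  open import Relation.Binary.Reasoning.Setoid setoid
  open import Algebra.Properties.Semiring.Sum semiring using (sum-cong-≋; ∑-distrib-+; *-distribˡ-sum; sum-replicate-zero)
  open import Algebra.Properties.Semiring.Exp semiring using (^-congˡ)
  open import Algebra.Properties.CommutativeSemigroup *-commutativeSemigroup using (x∙yz≈y∙xz)

  partial-cong : ∀ {b b′ : ℕ → Carrier} u N → (∀ i → b i ≈ b′ i) → partial R b u N ≈ partial R b′ u N
  partial-cong u N b≈b′ = sum-cong-≋ {N} λ i → *-congʳ (b≈b′ (toℕ i))

  partial-congᵘ : ∀ b {u u′} N → u ≈ u′ → partial R b u N ≈ partial R b u′ N
  partial-congᵘ b N u≈u′ = sum-cong-≋ {N} λ i → *-congˡ (^-congˡ (toℕ i) u≈u′)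

  partial-suc : ∀ b u N → partial R b u (suc N) ≈ b 0 + u * partial R (b ∘ suc) u N
  partial-suc b u N = +-cong (*-identityʳ _) (trans
    (sum-cong-≋ {N} λ i → x∙yz≈y∙xz (b (suc (toℕ i))) u (u ^ toℕ i))
    (sym (*-distribˡ-sum {N} u (λ i → b (suc (toℕ i)) * u ^ toℕ i))))

  partial-last : ∀ b u N → partial R b u (suc N) ≈ partial R b u N + b N * u ^ N
  partial-last b u N = Σ<-suc R (λ j → b j * u ^ j) N

  partial-+ : ∀ b b′ u N → partial R (λ i → b i + b′ i) u N ≈ partial R b u N + partial R b′ u N
  partial-+ b b′ u N = trans
    (sum-cong-≋ {N} λ i → distribʳ (u ^ toℕ i) (b (toℕ i)) (b′ (toℕ i)))
    (∑-distrib-+ {N} (λ i → b (toℕ i) * u ^ toℕ i) (λ i → b′ (toℕ i) * u ^ toℕ i))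

  partial-scale : ∀ a b u N → partial R (λ i → a * b i) u N ≈ a * partial R b u N
  partial-scale a b u N = trans
    (sum-cong-≋ {N} λ i → *-assoc a (b (toℕ i)) (u ^ toℕ i))
    (sym (*-distribˡ-sum {N} a (λ i → b (toℕ i) * u ^ toℕ i)))

  partial-zero : ∀ b u N → (∀ i → b i ≈ 0#) → partial R b u N ≈ 0#
  partial-zero b u N b≈0 = trans (sum-cong-≋ {N} λ i → trans (*-congʳ (b≈0 (toℕ i))) (zeroˡ _)) (sum-replicate-zero N)

  ∣-partial : ∀ {a} b u N → (∀ j → j < N → a ∣ b j) → a ∣ partial R b u N
  ∣-partial {a} b u zero    a∣b = 0# , zeroˡ a
  ∣-partial {a} b u (suc N) a∣b = ∣-respʳ R (sym (partial-last b u N))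
    (∣-+ R (∣-partial b u N λ j j<N → a∣b j (ℕₚ.m≤n⇒m≤1+n j<N))
           (∣-respʳ R (*-comm _ _) (∣-* R (u ^ N) (a∣b N ℕₚ.≤-refl))))

  -- Truncation is multiplicative modulo `u ^ N`. A multiple of `u ^ N` stands on each side so that
  -- no subtraction occurs and the semiring solver applies.
  partial-cauchy : ∀ b c u N → ∃₂ λ d e →
    partial R (cauchy R b c) u N + d * u ^ N ≈ partial R b u N * partial R c u N + e * u ^ N
  partial-cauchy b c u zero    = 0# , 0# , +-congʳ (sym (zeroˡ 0#))
  partial-cauchy b c u (suc N) with partial-cauchy (b ∘ suc) c u N
  ... | d , e , eq = d + β * c N , e , (begin
    partial R (cauchy R b c) u (suc N) + (d + β * c N) * (u * uᴺ)
      ≈⟨ +-congʳ (trans (partial-suc (cauchy R b c) u N) (+-cong (+-identityʳ _) (*-congˡ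
           (trans (partial-+ (λ i → b 0 * c (suc i)) (cauchy R (b ∘ suc) c) u N)
                  (+-congʳ (partial-scale (b 0) (c ∘ suc) u N)))))) ⟩
    b 0 * c 0 + u * (b 0 * γ + δ) + (d + β * c N) * (u * uᴺ)
      ≈⟨ solve 9 (λ b₀ c₀ u γ δ d β cₙ uᴺ →
           b₀ :* c₀ :+ u :* (b₀ :* γ :+ δ) :+ (d :+ β :* cₙ) :* (u :* uᴺ) :=
           b₀ :* (c₀ :+ u :* γ) :+ u :* (δ :+ d :* uᴺ) :+ u :* (β :* (cₙ :* uᴺ))) refl
           (b 0) (c 0) u γ δ d β (c N) uᴺ ⟩
    b 0 * (c 0 + u * γ) + u * (δ + d * uᴺ) + u * (β * (c N * uᴺ))
      ≈⟨ +-congʳ (+-congˡ (*-congˡ eq)) ⟩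
    b 0 * (c 0 + u * γ) + u * (β * partial R c u N + e * uᴺ) + u * (β * (c N * uᴺ))
      ≈⟨ +-congʳ (+-congʳ (*-congˡ (sym (partial-suc c u N)))) ⟩
    b 0 * C + u * (β * partial R c u N + e * uᴺ) + u * (β * (c N * uᴺ))
      ≈⟨ solve 7 (λ b₀ C u β P x t → b₀ :* C :+ u :* (β :* P :+ x) :+ u :* (β :* t) :=
           b₀ :* C :+ u :* β :* (P :+ t) :+ u :* x) refl
           (b 0) C u β (partial R c u N) (e * uᴺ) (c N * uᴺ) ⟩
    b 0 * C + u * β * (partial R c u N + c N * uᴺ) + u * (e * uᴺ)
      ≈⟨ +-cong (+-congˡ (*-congˡ (sym (partial-last c u N)))) (x∙yz≈y∙xz _ _ _) ⟩
    b 0 * C + u * β * C + e * (u * uᴺ)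
      ≈⟨ +-congʳ (trans (sym (distribʳ C (b 0) (u * β))) (*-congʳ (sym (partial-suc b u N)))) ⟩
    partial R b u (suc N) * C + e * (u * uᴺ) ∎)
    where
    open import Algebra.Solver.Ring.NaturalCoefficients.Default commutativeSemiring
    β γ δ C uᴺ : Carrier
    β = partial R (b ∘ suc) u N
    γ = partial R (c ∘ suc) u N
    δ = partial R (cauchy R (b ∘ suc) c) u N
    C = partial R c u (suc N)
    uᴺ = u ^ N

module _ {c ℓ c′ ℓ′ : Level} (R : CommutativeRing c ℓ) (S : CommutativeRing c′ ℓ′)
  {φ : CommutativeRing.Carrier R → CommutativeRing.Carrier S} (φ-hom : Homomorphism R S φ) where
  private
    module R = RingNotation R
    module S = RingNotation S
    module H = HomomorphismProperties R S φ-hom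

  partial-homo : ∀ b u N → φ (partial R b u N) S.≈ partial S (φ ∘ b) (φ u) N
  partial-homo b u N = S.trans (H.sum-homo {N} λ i → b (toℕ i) R.* u R.^ toℕ i)
    (sum-cong-≋ {N} λ i → S.trans (*-homo _ _) (S.*-congˡ (H.^-homo u (toℕ i))))
    where
    open RingMorphisms.IsRingHomomorphism φ-hom
    open import Algebra.Properties.CommutativeMonoid.Sum S.+-commutativeMonoid using (sum-cong-≋)

-- Evaluation of power series at ζ - 1.

module _ {c ℓ : Level} {p : ℕ} (p-prime : Prime p) (A : CommutativeRing c ℓ) (n : ℕ) where
  private module 𝒪 = RingNotation (Completion A p)

  module Evaluation (ζ : 𝒪.Carrier) (ζ^≈1 : ζ 𝒪.^ (p ℕ.^ n) 𝒪.≈ 𝒪.1#) where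
    private
      O : CommutativeRing _ _
      O = Completion A p
      module Q (k : ℕ) = RingNotation (R/p^ A p k)
      open CompletionProperties A p
      open PartialSums O
      open Compatible
    open 𝒪

    u : Carrier
    u = ζ - 1#

    abstract
      -- Opaque outside this block: what follows uses the laws proved here and never unfolds the
      -- limit.
      ev : (ℕ → Carrier) → Carrier
      ev = evaluate p-prime A n ζ ζ^≈1

      ev-evaluate : ∀ b → ev b ≈ evaluate p-prime A n ζ ζ^≈1 b
      ev-evaluate b = refl

      private
        K : ℕ → ℕ
        K k = k ℕ.* p ℕ.^ n

        p^∣u^ : ∀ k → nat p ^ k ∣ u ^ K k
        p^∣u^ k = ∣-power O (nat p) u (p ℕ.^ n) k (K k) (p∣[ζ-1]^ p-prime O n ζ ζ^≈1) ℕₚ.≤-refl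

        -- Level `k` is blind to multiples of p^k. The two correction terms match the shape of
        -- `partial-cauchy`.
        level-cong-modulo : ∀ {x y t} d e k → nat p ^ k ∣ t → x + d * t ≈ y + e * t →
          Q._≈_ k (approx x k) (approx y k)
        level-cong-modulo {x} {y} {t} d e k p^∣t eq = Q.trans k (Q.sym k (drop x d))
          (Q.trans k (CompatibleEq.at-level eq k) (drop y e))
          where
          drop : ∀ x d → Q._≈_ k (approx (x + d * t) k) (approx x k)
          drop x d = Q.trans k (Q.+-congˡ k (p^∣⇒level≡0 k {d * t} (∣-* O d p^∣t))) (Q.+-identityʳ k _)

      ev-cong : ∀ {b b′} → (∀ i → b i ≈ b′ i) → ev b ≈ ev b′
      ev-cong b≈b′ = levelwise λ k → CompatibleEq.at-level (partial-cong u (K k) b≈b′) k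

      ev-+ : ∀ b b′ → ev (λ i → b i + b′ i) ≈ ev b + ev b′
      ev-+ b b′ = levelwise λ k → CompatibleEq.at-level (partial-+ b b′ u (K k)) k

      ev-* : ∀ b b′ → ev (cauchy O b b′) ≈ ev b * ev b′
      ev-* b b′ = levelwise λ k → let d , e , eq = partial-cauchy b b′ u (K k) in
        level-cong-modulo d e k (p^∣u^ k) eq

      -- At level `k` the right side is the truncation of `b` with one term more than on the left.
      -- That term is a multiple of `u ^ K k`, hence of p^k.
      ev-suc : ∀ b → ev b ≈ b 0 + u * ev (b ∘ suc)
      ev-suc b = levelwise λ k → Q.sym k (level-cong-modulo 0# (b (K k)) k (p^∣u^ k) (begin
        b 0 + u * partial O (b ∘ suc) u (K k) + 0# * u ^ K k   ≈⟨ trans (+-congˡ (zeroˡ _)) (+-identityʳ _) ⟩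
        b 0 + u * partial O (b ∘ suc) u (K k)                  ≈⟨ partial-suc b u (K k) ⟨
        partial O b u (suc (K k))                              ≈⟨ partial-last b u (K k) ⟩
        partial O b u (K k) + b (K k) * u ^ K k                ∎))
        where open import Relation.Binary.Reasoning.Setoid setoid

      ev-zero : ∀ b → (∀ i → b i ≈ 0#) → ev b ≈ 0#
      ev-zero b b≈0 = levelwise λ k → CompatibleEq.at-level (partial-zero b u (K k) b≈0) k

    ev-constant : ∀ a → ev (constant O a) ≈ a
    ev-constant a = trans (ev-suc (constant O a))
      (trans (+-congˡ (trans (*-congˡ (ev-zero (constant O a ∘ suc) λ _ → refl)) (zeroʳ u))) (+-identityʳ a))

    ev-homomorphism : Homomorphism (O ⟦T⟧) O ev
    ev-homomorphism = homomorphism (O ⟦T⟧) O (λ e → ev-cong (SeriesEq.at e)) ev-+ ev-* (ev-constant 1#)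

    ev-scale : ∀ a b → ev (λ j → a * b j) ≈ a * ev b
    ev-scale a b = trans (ev-cong λ i → sym (cauchy-constantˡ O a b i))
      (trans (ev-* (constant O a) b) (*-congʳ (ev-constant a)))

    -- `ev-suc` iterated. Once p divides `u ^ N`, this shows that only the coefficients below `N`
    -- matter modulo p.
    ev-truncate : ∀ N b → ev b ≈ partial O b u N + ev (λ i → b (N ℕ.+ i)) * u ^ N
    ev-truncate zero    b = sym (trans (+-identityˡ _) (*-identityʳ _))
    ev-truncate (suc N) b = begin
      ev b                                              ≈⟨ ev-suc b ⟩
      b 0 + u * ev (b ∘ suc)                            ≈⟨ +-congˡ (*-congˡ (ev-truncate N (b ∘ suc))) ⟩
      b 0 + u * (partial O (b ∘ suc) u N + rest * u ^ N)  ≈⟨ +-congˡ (distribˡ _ _ _) ⟩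
      b 0 + (u * partial O (b ∘ suc) u N + u * (rest * u ^ N))  ≈⟨ +-assoc _ _ _ ⟨
      b 0 + u * partial O (b ∘ suc) u N + u * (rest * u ^ N)
        ≈⟨ +-cong (partial-suc b u N) (sym (x∙yz≈y∙xz _ _ _)) ⟨
      partial O b u (suc N) + rest * (u * u ^ N)        ∎
      where
      open import Relation.Binary.Reasoning.Setoid setoid
      open import Algebra.Properties.CommutativeSemigroup *-commutativeSemigroup using (x∙yz≈y∙xz)
      rest : Carrier
      rest = ev (λ i → b (suc (N ℕ.+ i)))

module _ {c ℓ c′ ℓ′ : Level} (R : CommutativeRing c ℓ) (S : CommutativeRing c′ ℓ′) (p : ℕ)
  {φ : CommutativeRing.Carrier R → CommutativeRing.Carrier S} (φ-hom : Homomorphism R S φ) where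
  private
    module R = RingNotation R
    module S = RingNotation S
    module H = HomomorphismProperties R S φ-hom
    open RingMorphisms.IsRingHomomorphism φ-hom

  Completion-map-homomorphism : Homomorphism (Completion R p) (Completion S p) (Completion-map p φ-hom)
  Completion-map-homomorphism = homomorphism (Completion R p) (Completion S p)
    (λ e → levelwise λ k → ∣⇒≡mod S _ (∣-respˡ S (p^-homo k)
      (∣-respʳ S (H.minus-homo _ _) (H.∣-homo (≡mod⇒∣ R _ (CompatibleEq.at-level e k))))))
    (λ x y → levelwise λ k → ≈⇒≡mod S _ (+-homo _ _))
    (λ x y → levelwise λ k → ≈⇒≡mod S _ (*-homo _ _))
    (levelwise λ k → ≈⇒≡mod S _ 1#-homo)
    where
    p^-homo : ∀ k → φ (R.nat p R.^ k) S.≈ S.nat p S.^ k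
    p^-homo k = S.trans (H.^-homo (R.nat p) k) (^-congˡ k (H.nat-homo p))
      where open import Algebra.Properties.Semiring.Exp S.semiring using (^-congˡ)

-- From facts about a ring to a specialisation over its completion.

module _ {c ℓ c′ ℓ′ : Level} {p : ℕ} (p-prime : Prime p)
  (R : CommutativeRing c ℓ) (A : CommutativeRing c′ ℓ′) where
  private
    module R = RingNotation R
    module A = RingNotation A
    module O = RingNotation (Completion A p)

  module CompletedSpecialisation (R-torsion-free : ∀ x → R.nat p R.* x R.≈ R.0# → x R.≈ R.0#)
    (A-torsion-free : ∀ x → A.nat p A.* x A.≈ A.0# → x A.≈ A.0#)
    {φ : R.Carrier → A.Carrier} (φ-hom : Homomorphism R A φ)
    (n N : ℕ) (z : A.Carrier)
    (p∣[z-1]^N : A.nat p A.∣ ((z A.- A.1#) A.^ N))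
    (independent : ∀ (b : ℕ → R.Carrier) → A.nat p A.∣ partial A (φ ∘ b) (z A.- A.1#) N →
                   ∀ j → j < N → R.nat p R.∣ b j)
    (generates : ∀ a → ∃₂ λ (f : ℕ → R.Carrier) m → a A.≈ partial A (φ ∘ f) z m)
    -- `ζ` is the image of `z` only up to provable equality: it will be a value of a character,
    -- which does not compute to the root of unity.
    (ζ : O.Carrier) (ζ≈z : ζ O.≈ diagonal A p z) (ζ^≈1 : ζ O.^ (p ℕ.^ n) O.≈ O.1#) where
    private
      O B : CommutativeRing _ _
      O = Completion A p
      B = Completion R p
      module B = RingNotation B
      φᶜ : B.Carrier → O.Carrier
      φᶜ = Completion-map p φ-hom
      φᶜ-hom : Homomorphism B O φᶜ
      φᶜ-hom = Completion-map-homomorphism R A p φ-hom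
      module φᶜ = HomomorphismProperties B O φᶜ-hom
      module A/p = RingNotation (R/p^ A p 1)
      module OC = CompletionProperties A p
      open Compatible
      δ : A.Carrier → O.Carrier
      δ = diagonal A p
      module δ = HomomorphismProperties A O OC.diagonal-homomorphism

    module Ev = Evaluation p-prime A n ζ ζ^≈1
    open Ev using (u)

    EV : Series B → O.Carrier
    EV b = Ev.ev (φᶜ ∘ b)

    EV≈evaluate : ∀ b b′ → (∀ j → Completion-map p φ-hom (b j) O.≈ b′ j) → EV b O.≈ evaluate p-prime A n ζ ζ^≈1 b′
    EV≈evaluate b b′ b≈b′ = O.trans (Ev.ev-cong b≈b′) (Ev.ev-evaluate b′)

    EV-homomorphism : Homomorphism (B ⟦T⟧) O EV
    EV-homomorphism = Composition.isRingHomomorphism O.trans φᶜ.series-homomorphism Ev.ev-homomorphism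

    private
      module EV = RingMorphisms.IsRingHomomorphism EV-homomorphism

      u≈z-1 : u O.≈ δ (z A.- A.1#)
      u≈z-1 = O.trans (O.+-congʳ ζ≈z) (O.sym (δ.minus-homo z A.1#))

      p∣u^N : O.nat p O.∣ (u O.^ N)
      p∣u^N = ∣-respˡ O (δ.nat-homo p) (∣-respʳ O
        (O.sym (O.trans (^-congˡ N u≈z-1) (O.sym (δ.^-homo (z A.- A.1#) N)))) (δ.∣-homo p∣[z-1]^N))
        where open import Algebra.Properties.Semiring.Exp O.semiring using (^-congˡ)

      -- The terms from `N` on are divisible by p, so p divides the truncation. At level 1 this is a
      -- divisibility in `A`, where `independent` applies.
      injective : ∀ b → O.nat p O.∣ EV b → ∀ j → j < N → B.nat p B.∣ b j
      injective b p∣EVb j j<N = CompletionProperties.p∣level₁⇒p∣ R p R-torsion-free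
        (independent (λ j → approx (b j) 1) (∣-respˡ A (A.*-identityʳ _) (≡0mod⇒∣ A _ (begin
          partial A b₁ (z A.- A.1#) N
            ≈⟨ partial-homo A (R/p^ A p 1) (quotient-homomorphism A _) b₁ (z A.- A.1#) N ⟩
          partial (R/p^ A p 1) b₁ (z A.- A.1#) N
            ≈⟨ PartialSums.partial-congᵘ (R/p^ A p 1) b₁ N (CompatibleEq.at-level u≈z-1 1) ⟨
          partial (R/p^ A p 1) b₁ (approx u 1) N
            ≈⟨ partial-homo O (R/p^ A p 1) (OC.level-homomorphism 1) (φᶜ ∘ b) u N ⟨
          approx (partial O (φᶜ ∘ b) u N) 1
            ≈⟨ ∣⇒≡0mod A _ (∣-respˡ A (A.sym (A.*-identityʳ _)) (OC.p∣⇒p∣level₁ p∣partial)) ⟩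
          A.0#                           ∎))) j j<N)
        where
        open import Relation.Binary.Reasoning.Setoid A/p.setoid
        b₁ : ℕ → A.Carrier
        b₁ j = φ (approx (b j) 1)
        p∣partial : O.nat p O.∣ partial O (φᶜ ∘ b) u N
        p∣partial = ∣-cancelʳ O (∣-respʳ O (Ev.ev-truncate N (φᶜ ∘ b)) p∣EVb) (∣-* O _ p∣u^N)

      vanishing : ∀ b → (∀ j → j < N → B.nat p B.∣ b j) → O.nat p O.∣ EV b
      vanishing b p∣b = ∣-respʳ O (O.sym (Ev.ev-truncate N (φᶜ ∘ b))) (∣-+ O
        (PartialSums.∣-partial O (φᶜ ∘ b) u N λ j j<N → ∣-respˡ O (φᶜ.nat-homo p) (φᶜ.∣-homo (p∣b j j<N)))
        (∣-* O _ p∣u^N))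

      1+T : Series B
      1+T zero    = B.1#
      1+T (suc i) = constant B B.1# i

      EV[1+T]≈ζ : EV 1+T O.≈ ζ
      EV[1+T]≈ζ = begin
        EV 1+T                                ≈⟨ Ev.ev-suc (φᶜ ∘ 1+T) ⟩
        φᶜ B.1# O.+ u O.* EV (constant B B.1#) ≈⟨ O.+-cong (RingMorphisms.IsRingHomomorphism.1#-homo φᶜ-hom)
                                                   (O.trans (O.*-congˡ EV.1#-homo) (O.*-identityʳ u)) ⟩
        O.1# O.+ u                            ≈⟨ x≈y+[x-y] O ζ O.1# ⟨
        ζ                                     ∎
        where open import Relation.Binary.Reasoning.Setoid O.setoid

      EV-constant : ∀ r → EV (constant B (diagonal R p r)) O.≈ δ (φ r)
      EV-constant r = O.trans (Ev.ev-cong λ { zero → levelwise λ k → A/p^-refl k ; (suc i) → 0#-homo })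
                              (Ev.ev-constant (δ (φ r)))
        where
        open RingMorphisms.IsRingHomomorphism φᶜ-hom using (0#-homo)
        A/p^-refl : ∀ k {x} → CongruentMod A (A.nat p A.^ k) x x
        A/p^-refl k = CommutativeRing.refl (R/p^ A p k)

      -- Horner's rule with ζ replaced by the series `1+T`, whose value is ζ.
      polynomial-values : ∀ (f : ℕ → R.Carrier) m → ∃ λ b → partial O (δ ∘ φ ∘ f) ζ m O.≈ EV b
      polynomial-values f zero    = B⟦T⟧.0# , O.sym EV.0#-homo
        where module B⟦T⟧ = CommutativeRing (B ⟦T⟧)
      polynomial-values f (suc m) with polynomial-values (f ∘ suc) m
      ... | b , e = constant B (diagonal R p (f 0)) B⟦T⟧.+ 1+T B⟦T⟧.* b , (begin
        partial O (δ ∘ φ ∘ f) ζ (suc m)         ≈⟨ PartialSums.partial-suc O (δ ∘ φ ∘ f) ζ m ⟩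
        δ (φ (f 0)) O.+ ζ O.* partial O (δ ∘ φ ∘ f ∘ suc) ζ m
          ≈⟨ O.+-cong (EV-constant (f 0)) (O.*-cong EV[1+T]≈ζ (O.sym e)) ⟨
        EV (constant B (diagonal R p (f 0))) O.+ EV 1+T O.* EV b
          ≈⟨ O.+-congˡ (EV.*-homo 1+T b) ⟨
        EV (constant B (diagonal R p (f 0))) O.+ EV (1+T B⟦T⟧.* b)
          ≈⟨ EV.+-homo (constant B (diagonal R p (f 0))) (1+T B⟦T⟧.* b) ⟨
        EV (constant B (diagonal R p (f 0)) B⟦T⟧.+ 1+T B⟦T⟧.* b) ∎)
        where
        module B⟦T⟧ = CommutativeRing (B ⟦T⟧)
        open import Relation.Binary.Reasoning.Setoid O.setoid

      -- Modulo p only `approx x 1` counts, and it is a polynomial in `z` by `generates`.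
      surjective : ∀ x → ∃ λ b → CongruentMod O (O.nat p) x (EV b)
      surjective x = let f , m , a≈ = generates (approx x 1)
                         b , e = polynomial-values f m in
        b , Op.trans (OC.≡mod-level₁ A-torsion-free x) (≈⇒≡mod O _ (begin
          δ (approx x 1)                       ≈⟨ RingMorphisms.IsRingHomomorphism.⟦⟧-cong OC.diagonal-homomorphism a≈ ⟩
          δ (partial A (φ ∘ f) z m)            ≈⟨ partial-homo A O OC.diagonal-homomorphism (φ ∘ f) z m ⟩
          partial O (δ ∘ φ ∘ f) (δ z) m        ≈⟨ PartialSums.partial-congᵘ O (δ ∘ φ ∘ f) m ζ≈z ⟨
          partial O (δ ∘ φ ∘ f) ζ m            ≈⟨ e ⟩
          EV b                                 ∎))
        where
        module Op = CommutativeRing (Quotient O (O.nat p))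
        open import Relation.Binary.Reasoning.Setoid O.setoid

    specialisation : Specialisation B O (B.nat p) (O.nat p) N
    specialisation = record
      { ev              = EV
      ; ev-homomorphism = EV-homomorphism
      ; ev-scale        = λ b → O.trans
          (Ev.ev-cong λ i → O.trans (RingMorphisms.IsRingHomomorphism.*-homo φᶜ-hom (B.nat p) (b i))
                                    (O.*-congʳ (φᶜ.nat-homo p)))
          (Ev.ev-scale (O.nat p) (φᶜ ∘ b))
      ; torsion-free    = OC.completion-torsion-free A-torsion-free
      ; injective-mod   = injective
      ; vanishing-mod   = vanishing
      ; surjective-mod  = surjective
      }

-- Geometric sums, torsion and independence in quotient rings.

module _ {c ℓ : Level} (S : CommutativeRing c ℓ) where
  open RingNotation S
  open import Relation.Binary.Reasoning.Setoid setoid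

  1^n≈1 : ∀ n → 1# ^ n ≈ 1#
  1^n≈1 zero    = refl
  1^n≈1 (suc n) = trans (*-identityˡ _) (1^n≈1 n)

  geometric-sum : ∀ w y k → y ≈ w + 1# → Σ< S (y ^_) k * w + 1# ≈ y ^ k
  geometric-sum w y zero    y≈w+1 = trans (+-congʳ (zeroˡ w)) (+-identityˡ 1#)
  geometric-sum w y (suc k) y≈w+1 = begin
    Σ< S (y ^_) (suc k) * w + 1#              ≈⟨ +-congʳ (*-congʳ (Σ<-suc S (y ^_) k)) ⟩
    (Σ< S (y ^_) k + y ^ k) * w + 1#          ≈⟨ +-congʳ (distribʳ _ _ _) ⟩
    Σ< S (y ^_) k * w + y ^ k * w + 1#        ≈⟨ xy∙z≈y∙xz _ _ _ ⟩
    y ^ k * w + (Σ< S (y ^_) k * w + 1#)      ≈⟨ +-cong (*-comm _ _) (geometric-sum w y k y≈w+1) ⟩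
    w * y ^ k + y ^ k                         ≈⟨ +-congˡ (*-identityˡ _) ⟨
    w * y ^ k + 1# * y ^ k                    ≈⟨ distribʳ _ _ _ ⟨
    (w + 1#) * y ^ k                          ≈⟨ *-congʳ y≈w+1 ⟨
    y * y ^ k                                 ∎
    where open import Algebra.Properties.CommutativeSemigroup +-commutativeSemigroup using (xy∙z≈y∙xz)

  cancel-^ : ∀ t → (∀ x → t * x ≈ 0# → x ≈ 0#) → ∀ n x → t ^ n * x ≈ 0# → x ≈ 0#
  cancel-^ t cancel zero    x e = trans (sym (*-identityˡ x)) e
  cancel-^ t cancel (suc n) x e = cancel-^ t cancel n x (cancel (t ^ n * x) (trans (sym (*-assoc _ _ _)) e))

  z≈[x-1]y⇒y+z≈xy : ∀ x y z → z ≈ (x - 1#) * y → y + z ≈ x * y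
  z≈[x-1]y⇒y+z≈xy x y z e = begin
    y + z                  ≈⟨ +-congˡ e ⟩
    y + (x - 1#) * y       ≈⟨ +-congˡ (trans ([y-z]x≈yx-zx y x 1#) (+-congˡ (-‿cong (*-identityˡ y)))) ⟩
    y + (x * y - y)        ≈⟨ x≈y+[x-y] S (x * y) y ⟨
    x * y                  ∎
    where open RingProperties ring using ([y-z]x≈yx-zx)

  -- Uniqueness of t-adic digits. The lowest digit is a multiple of `t`, hence zero; then `t`
  -- cancels from what remains and the next digit becomes the lowest.
  independent-mod-power : ∀ {a z} {I : Set a} (κ : I → Carrier) t → (∀ x → t * x ≈ 0# → x ≈ 0#) →
    (Zero : I → Set z) → (∀ b h → κ b ≈ t * h → Zero b) → (∀ b → Zero b → κ b ≈ 0#) →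
    ∀ N (b : ℕ → I) d → partial S (κ ∘ b) t N ≈ d * t ^ N → ∀ j → j < N → Zero (b j)
  independent-mod-power κ t t-cancel Zero multiple⇒zero zero⇒≈0 (suc N) b d e = go
    where
    open RingProperties ring using (x[y-z]≈xy-xz)
    open import Algebra.Properties.CommutativeSemigroup *-commutativeSemigroup using (x∙yz≈y∙xz)
    tail rest : Carrier
    tail = partial S (κ ∘ b ∘ suc) t N
    rest = d * t ^ N
    b₀≈t[rest-tail] : κ (b 0) ≈ t * (rest - tail)
    b₀≈t[rest-tail] = sym (trans (x[y-z]≈xy-xz t rest tail) (x≈y+z⇒x-y≈z S (begin
      t * rest                           ≈⟨ x∙yz≈y∙xz d t (t ^ N) ⟨
      d * (t * t ^ N)                    ≈⟨ e ⟨
      partial S (κ ∘ b) t (suc N)        ≈⟨ PartialSums.partial-suc S (κ ∘ b) t N ⟩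
      κ (b 0) + t * tail                 ≈⟨ +-comm _ _ ⟩
      t * tail + κ (b 0)                 ∎)))
    b₀-zero : Zero (b 0)
    b₀-zero = multiple⇒zero (b 0) (rest - tail) b₀≈t[rest-tail]
    go : ∀ j → j < suc N → Zero (b j)
    go zero    _         = b₀-zero
    go (suc j) (s≤s j<N) = independent-mod-power κ t t-cancel Zero multiple⇒zero zero⇒≈0 N (b ∘ suc) d
      (sym (x-y≈0⇒x≈y S (t-cancel (rest - tail)
        (trans (sym b₀≈t[rest-tail]) (zero⇒≈0 (b 0) b₀-zero))))) j j<N

  -- The exchange argument for a regular sequence: if n x = c a, then a c vanishes modulo n, so c =
  -- d n by cancelling `a`; cancelling n gives x = d a.
  quotient-torsion-free : ∀ n a →
    (∀ x → CongruentMod S (nat n) (a * x) 0# → CongruentMod S (nat n) x 0#) →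
    (∀ x → nat n * x ≈ 0# → x ≈ 0#) →
    let module Q = RingNotation (Quotient S a) in ∀ x → Q.nat n Q.* x Q.≈ Q.0# → x Q.≈ Q.0#
  quotient-torsion-free n a cancel torsion-free x nx≡0
    with ≡0mod⇒∣ S a (Q.trans (Q.*-congʳ {x} (HomomorphismProperties.nat-homo S (Quotient S a) (quotient-homomorphism S a) n)) nx≡0)
    where module Q = RingNotation (Quotient S a)
  ... | c , ca≈nx
    with ≡0mod⇒∣ S (nat n) (cancel c (N.trans (≈⇒≡mod S _ (trans (*-comm a c) ca≈nx))
           (N.trans (N.*-congʳ {x} (a≡0 S (nat n))) (N.zeroˡ x))))
    where module N = CommutativeRing (Quotient S (nat n))
  ... | d , dn≈c = ∣⇒≡0mod S a (d , x-y≈0⇒x≈y S (torsion-free _ (begin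
      nat n * (d * a - x)            ≈⟨ x[y-z]≈xy-xz (nat n) (d * a) x ⟩
      nat n * (d * a) - nat n * x    ≈⟨ x≈y⇒x-y≈0 S (begin
          nat n * (d * a)            ≈⟨ x∙yz≈yx∙z (nat n) d a ⟩
          d * nat n * a              ≈⟨ *-congʳ dn≈c ⟩
          c * a                      ≈⟨ ca≈nx ⟩
          nat n * x                  ∎) ⟩
      0#                             ∎)))
    where
    open RingProperties ring using (x[y-z]≈xy-xz)
    open import Algebra.Properties.CommutativeSemigroup *-commutativeSemigroup using (x∙yz≈yx∙z)

  -- As `a` and `t` agree modulo n, the ideals (n, a) and (n, t) coincide. This lemma and the next
  -- pass between the two descriptions.
  nat∣-quotient : ∀ n {a t} → CongruentMod S (nat n) a t →
    let module Q = RingNotation (Quotient S a) in Q.nat n Q.∣ t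
  nat∣-quotient n {a} {t} a≡t = ∣-cancelʳ (Quotient S a) {x = t}
    (Q.0# Q., Q.trans (Q.zeroˡ _) (Q.trans (Q.sym (a≡0 S a)) (≈⇒≡mod S a (proj₂ (≡mod⇒+ S _ a≡t)))))
    (proj₁ (≡mod⇒+ S _ a≡t) Q., Q.*-congˡ (Q.sym (HomomorphismProperties.nat-homo S (Quotient S a) (quotient-homomorphism S a) n)))
    where module Q = RingNotation (Quotient S a)

  nat∣-quotient⇒multiple : ∀ n {a t f} → CongruentMod S (nat n) a t →
    let module Q = RingNotation (Quotient S a) in Q.nat n Q.∣ f →
    ∃ λ d → CongruentMod S (nat n) f (d * t)
  nat∣-quotient⇒multiple n {a} {t} {f} a≡t (q , qn≈f)
    = let d , f≈qn+da = ≡mod⇒+ S a (Q.trans (Q.sym qn≈f)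
           (Q.*-congˡ (Q.sym (HomomorphismProperties.nat-homo S (Quotient S a) (quotient-homomorphism S a) n))))
      in d , N.trans (≈⇒≡mod S _ f≈qn+da)
      (N.trans (N.+-cong (N.trans (N.*-congˡ (a≡0 S (nat n))) (N.zeroʳ q)) (N.*-congˡ a≡t)) (N.+-identityˡ _))
    where
    module Q = RingNotation (Quotient S a)
    module N = RingNotation (Quotient S (nat n))

  -- Carries independence from S / n modulo `t ^ N`, where digits can be peeled off, over to S / a
  -- modulo n.
  quotient-independent : ∀ {i z} n {a} {I : Set i} (κ : I → Carrier) t N →
    CongruentMod S (nat n) a (t ^ N) → (Zero : I → Set z) →
    let module E = RingNotation (Quotient S (nat n))
        module Q = RingNotation (Quotient S a) in
    (∀ b d → partial (Quotient S (nat n)) (κ ∘ b) t N E.≈ d E.* t E.^ N → ∀ j → j < N → Zero (b j)) →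
    ∀ b → Q.nat n Q.∣ partial (Quotient S a) (κ ∘ b) t N → ∀ j → j < N → Zero (b j)
  quotient-independent n {a} κ t N a≡t^N Zero independent b n∣partial =
    let d , e = nat∣-quotient⇒multiple n a≡t^N (∣-respʳ (Quotient S a)
                  (Q.sym (partial-homo S (Quotient S a) (quotient-homomorphism S a) (κ ∘ b) t N)) n∣partial)
    in independent b d (E.trans
         (E.sym (partial-homo S (Quotient S (nat n)) (quotient-homomorphism S (nat n)) (κ ∘ b) t N))
         (E.trans e (E.*-congˡ {d} (HomomorphismProperties.^-homo S (Quotient S (nat n))
           (quotient-homomorphism S (nat n)) t N))))
    where
    module Q = RingNotation (Quotient S a)
    module E = RingNotation (Quotient S (nat n))

module _ {c ℓ c′ ℓ′ : Level} (R : CommutativeRing c ℓ) (S : CommutativeRing c′ ℓ′)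
  {φ : CommutativeRing.Carrier R → CommutativeRing.Carrier S} (φ-hom : Homomorphism R S φ) where
  private
    module R = RingNotation R
    module S = RingNotation S
    module H = HomomorphismProperties R S φ-hom
  open import Algebra.Properties.CommutativeMonoid.Sum S.+-commutativeMonoid using (sum-cong-≋)
  open import Algebra.Properties.Semiring.Exp S.semiring using (^-congˡ)

  Σ<-power-homo : ∀ x q k → Σ< S ((φ x S.^ q) S.^_) k S.≈ φ (Σ< R ((x R.^ q) R.^_) k)
  Σ<-power-homo x q k = S.sym (S.trans (H.sum-homo {k} λ i → (x R.^ q) R.^ toℕ i)
    (sum-cong-≋ {k} λ i → S.trans (H.^-homo (x R.^ q) (toℕ i)) (^-congˡ (toℕ i) (H.^-homo x q))))

-- Multiplying by t^q with q = p^m turns both sides into t^(q p), since x^q = t^q + 1.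
geometric-sum-mod-p : {p : ℕ} (p-prime : Prime p) {c ℓ : Level} (S : CommutativeRing c ℓ)
  (let open RingNotation S) → nat p ≈ 0# → ∀ t → (∀ x → t * x ≈ 0# → x ≈ 0#) →
  ∀ m x → x ≈ t + 1# → Σ< S ((x ^ (p ℕ.^ m)) ^_) p ≈ t ^ (p ℕ.^ m ℕ.* (p ∸ 1))
geometric-sum-mod-p {p} p-prime S p≈0 t t-cancel m x x≈t+1 =
  x-y≈0⇒x≈y S (cancel-^ S t t-cancel q _ (trans (x[y-z]≈xy-xz _ _ _)
    (x≈y⇒x-y≈0 S (+-cancelʳ 1# _ _ (begin
      w * Σ< S (y ^_) p + 1#          ≈⟨ +-congʳ (*-comm _ _) ⟩
      Σ< S (y ^_) p * w + 1#          ≈⟨ geometric-sum S w y p y≈w+1 ⟩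
      y ^ p                           ≈⟨ ^-congˡ p y≈w+1 ⟩
      (w + 1#) ^ p                    ≈⟨ frobenius p-prime S p≈0 w ⟩
      w ^ p + 1#                      ≈⟨ +-congʳ (trans (^-assocʳ t q p) (trans (^-congʳ t qp≡q+N) (^-homo-* t q _))) ⟩
      w * t ^ (q ℕ.* (p ∸ 1)) + 1#    ∎)))))
  where
  open RingNotation S
  open RingProperties ring using (x[y-z]≈xy-xz; +-cancelʳ)
  open import Algebra.Properties.Semiring.Exp semiring using (^-congˡ; ^-congʳ; ^-assocʳ; ^-homo-*)
  open import Relation.Binary.Reasoning.Setoid setoid
  instance _ = prime⇒nonZero p-prime
  q : ℕ
  q = p ℕ.^ m
  w y : Carrier
  w = t ^ q
  y = x ^ q
  qp≡q+N : q ℕ.* p ≡ q ℕ.+ q ℕ.* (p ∸ 1)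
  qp≡q+N = ≡.trans (≡.cong (q ℕ.*_) (≡.sym (ℕₚ.suc-pred p))) (ℕₚ.*-suc q (p ∸ 1))
  y≈w+1 : y ≈ w + 1#
  y≈w+1 = trans (^-congˡ q x≈t+1) (frobeniusⁿ p-prime S p≈0 m t)

-- Coefficients of polynomials.

module PolynomialProperties {c ℓ : Level} (R : CommutativeRing c ℓ) where
  private
    module R = RingNotation R
    module P = RingNotation (R [X])
  open Polynomial

  coefficient-≈ : ∀ {f g : P.Carrier} → f P.≈ g → ∀ i → coefficient f i R.≈ coefficient g i
  coefficient-≈ e = SeriesEq.at (PolynomialEq.atₚ e)

  coefficient-nat* : ∀ m f i → coefficient (P.nat m P.* f) i R.≈ R.nat m R.* coefficient f i
  coefficient-nat* m f i = R.trans
    (coefficient-≈ (P.*-congʳ {f} {P.nat m} {constantₚ R (R.nat m)}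
      (P.sym (HomomorphismProperties.nat-homo R (R [X]) (constantₚ-isRingHomomorphism R) m))) i)
    (cauchy-constantˡ R (R.nat m) (coefficient f) i)

  constant-coefficient-homomorphism : Homomorphism (R [X]) R (λ f → coefficient f 0)
  constant-coefficient-homomorphism = homomorphism (R [X]) R (λ e → coefficient-≈ e 0)
    (λ _ _ → R.refl) (λ _ _ → R.+-identityʳ _) R.refl

  coefficient-X*-zero : ∀ f → coefficient (X R P.* f) 0 R.≈ R.0#
  coefficient-X*-zero f = R.trans (R.+-identityʳ _) (R.zeroˡ _)

  coefficient-X*-suc : ∀ f i → coefficient (X R P.* f) (suc i) R.≈ coefficient f i
  coefficient-X*-suc f i = R.trans (R.+-cong (R.zeroˡ _) (R.trans (SeriesEq.at
      (T.*-congʳ {coefficient f} {coefficient (X R) ∘ suc} {constant R R.1#}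
        (coefficientwise λ { zero → R.refl ; (suc _) → R.refl })) i)
      (SeriesEq.at (T.*-identityˡ (coefficient f)) i)))
    (R.+-identityˡ _)
    where module T = CommutativeRing (R ⟦T⟧)

  -- `m` is kept apart from `bound f` so that the induction can pass to the shifted polynomial `f′`,
  -- where `f` is its constant term plus X times `f′`.
  polynomial-expansion : ∀ f m → (∀ i → m ≤ i → coefficient f i R.≈ R.0#) →
    f P.≈ partial (R [X]) (constantₚ R ∘ coefficient f) (X R) m
  polynomial-expansion f zero    f≈0 = coefficientwiseₚ (coefficientwise λ i → f≈0 i z≤n)
  polynomial-expansion f (suc m) f≈0 = P.trans
    (coefficientwiseₚ (coefficientwise λ
      { zero    → R.sym (R.trans (R.+-congˡ (coefficient-X*-zero f′)) (R.+-identityʳ _))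
      ; (suc i) → R.sym (R.trans (R.+-congˡ (coefficient-X*-suc f′ i)) (R.+-identityˡ _)) }))
    (P.trans (P.+-congˡ {constantₚ R (coefficient f 0)} {X R P.* f′} {X R P.* partial (R [X]) (constantₚ R ∘ coefficient f′) (X R) m}
               (P.*-congˡ {X R} {f′} (polynomial-expansion f′ m (λ i m≤i → f≈0 (suc i) (s≤s m≤i)))))
             (P.sym (PartialSums.partial-suc (R [X]) (constantₚ R ∘ coefficient f) (X R) m)))
    where
    f′ : P.Carrier
    f′ = polynomial (coefficient f ∘ suc) m (λ i m≤i → f≈0 (suc i) (s≤s m≤i))

  nat∣coefficient : ∀ m {f} → P.nat m P.∣ f → ∀ i → R.nat m R.∣ coefficient f i
  nat∣coefficient m (q P., e) i = coefficient q i R., R.trans (R.*-comm _ _)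
    (R.trans (R.sym (coefficient-nat* m q i)) (coefficient-≈ (P.trans (P.*-comm (P.nat m) q) e) i))

  module _ (m : ℕ) (torsion-free : ∀ x → R.nat m R.* x R.≈ R.0# → x R.≈ R.0#) where

    polynomial-torsion-free : ∀ f → P.nat m P.* f P.≈ P.0# → f P.≈ P.0#
    polynomial-torsion-free f e = coefficientwiseₚ (coefficientwise λ i →
      torsion-free _ (R.trans (R.sym (coefficient-nat* m f i)) (coefficient-≈ e i)))

    nat∣polynomial : ∀ f → (∀ i → R.nat m R.∣ coefficient f i) → P.nat m P.∣ f
    nat∣polynomial f m∣f = quotient P., coefficientwiseₚ (coefficientwise λ i → R.trans
      (coefficient-≈ (P.*-comm quotient (P.nat m)) i)
      (R.trans (coefficient-nat* m quotient i) (mq≈f i)))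
      where
      q : ℕ → R.Carrier
      q i = let (q R., _) = m∣f i in q
      mq≈f : ∀ i → R.nat m R.* q i R.≈ coefficient f i
      mq≈f i = let (_ R., e) = m∣f i in R.trans (R.*-comm _ _) e
      quotient : P.Carrier
      -- Torsion-freeness is what bounds the degree: beyond `bound f` the product of `nat m` with
      -- `q i` is zero, hence so is `q i`.
      quotient = polynomial q (bound f) λ i h → torsion-free _ (R.trans (mq≈f i) (vanishes f i h))

-- Integers modulo p, the ring 𝔽_p[X] and cyclotomic polynomials.

private
  module ℤR = RingNotation ℤ-ring
  module P = RingNotation ℤ[X]
  open Polynomial
  module PP = PolynomialProperties ℤ-ring

nat≡+ : ∀ m → ℤR.nat m ≡ + m
nat≡+ zero    = ≡.refl
nat≡+ (suc m) = ≡.cong (λ x → + 1 ℤ.+ x) (nat≡+ m)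

signed⇒ring-∣ : ∀ {m x} → + m ℤ∣.∣ x → ℤR.nat m ℤR.∣ x
signed⇒ring-∣ {m} (ℤ∣.divides q x≡qm) = q ℤR., ≡.trans (≡.cong (q ℤ.*_) (nat≡+ m)) (≡.sym x≡qm)

ring⇒signed-∣ : ∀ {m x} → ℤR.nat m ℤR.∣ x → + m ℤ∣.∣ x
ring⇒signed-∣ {m} (q ℤR., e) = ℤ∣.divides q (≡.trans (≡.sym e) (≡.cong (q ℤ.*_) (nat≡+ m)))

nat∣? : ∀ m x → Dec (ℤR.nat m ℤR.∣ x)
nat∣? m x = map′ (signed⇒ring-∣ {m}) (ring⇒signed-∣ {m}) (+ m ℤ∣.∣? x)

module _ {p : ℕ} (p-prime : Prime p) where
  private instance
    _ = prime⇒nonZero p-prime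
    _ = prime⇒nonTrivial p-prime

  ℤ-torsion-free : ∀ x → ℤR.nat p ℤ.* x ≡ + 0 → x ≡ + 0
  ℤ-torsion-free x e with ℤₚ.i*j≡0⇒i≡0∨j≡0 (+ p) (≡.trans (≡.cong (ℤ._* x) (≡.sym (nat≡+ p))) e)
  ... | inj₁ p≡0 = contradiction (ℤₚ.+-injective p≡0) (ℕ.≢-nonZero⁻¹ p)
  ... | inj₂ x≡0 = x≡0

  ℤ-euclid : ∀ x y → ℤR.nat p ℤR.∣ x ℤ.* y → ℤR.nat p ℤR.∣ x ⊎ ℤR.nat p ℤR.∣ y
  ℤ-euclid x y p∣xy = Sum.map (signed⇒ring-∣ ∘ ℤ∣.∣ᵤ⇒∣) (signed⇒ring-∣ ∘ ℤ∣.∣ᵤ⇒∣)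
    (euclidsLemma ∣ x ∣ ∣ y ∣ p-prime
      (≡.subst (p ℕ∣.∣_) (ℤₚ.abs-* x y) (ℤ∣.∣⇒∣ᵤ (ring⇒signed-∣ p∣xy))))

  p∤1 : ℤR.nat p ℤR.∤ (+ 1)
  p∤1 p∣1 = ℕ∣.>⇒∤ (ℕ.nonTrivial⇒n>1 p) (ℤ∣.∣⇒∣ᵤ (ring⇒signed-∣ p∣1))

  private
    F E : CommutativeRing _ _
    F = Quotient ℤ-ring (ℤR.nat p)
    E = Quotient ℤ[X] (P.nat p)
    module F = RingNotation F
    module E = RingNotation E
    module toE = HomomorphismProperties ℤ[X] E (quotient-homomorphism ℤ[X] (P.nat p))

    F-domain : ∀ x y → x F.* y F.≈ F.0# → x F.≈ F.0# ⊎ y F.≈ F.0#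
    F-domain x y e = Sum.map (∣⇒≡0mod ℤ-ring _) (∣⇒≡0mod ℤ-ring _) (ℤ-euclid x y (≡0mod⇒∣ ℤ-ring _ e))

    coefficient-≡mod : ∀ {f h} → f E.≈ h → ∀ i → coefficient f i F.≈ coefficient h i
    coefficient-≡mod e i = ∣⇒≡mod ℤ-ring _ (PP.nat∣coefficient p (≡mod⇒∣ ℤ[X] _ e) i)

    coefficients-≡mod : ∀ {f} → (∀ i → coefficient f i F.≈ F.0#) → f E.≈ E.0#
    coefficients-≡mod e = ∣⇒≡0mod ℤ[X] _ (PP.nat∣polynomial p ℤ-torsion-free _ λ i → ≡0mod⇒∣ ℤ-ring _ (e i))

    -- `E` is 𝔽_p[X]; read inside 𝔽_p[[X]], a factor with nonzero constant term cancels.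
    cancel : ∀ t → ¬ coefficient t 0 F.≈ F.0# → ∀ f → t E.* f E.≈ E.0# → f E.≈ E.0#
    cancel t t₀≢0 f tf≡0 = coefficients-≡mod (cauchy-cancel-invertible F F-domain (coefficient f) (coefficient t) t₀≢0
      λ i → F.trans (cauchy-comm F (coefficient f) (coefficient t) i) (coefficient-≡mod tf≡0 i))

  ℤ[X]-torsion-free : ∀ f → P.nat p P.* f P.≈ P.0# → f P.≈ P.0#
  ℤ[X]-torsion-free = PP.polynomial-torsion-free p ℤ-torsion-free

  T : P.Carrier
  T = X ℤ-ring P.- P.1#

  private
    T-cancel : ∀ f → T E.* f E.≈ E.0# → f E.≈ E.0#
    -- The constant term of X - 1 is -1, and p would divide 1.
    T-cancel = cancel T λ e → p∤1 (≡mod-neg (≡0mod⇒∣ ℤ-ring _ e))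
      where
      ≡mod-neg : ℤR.nat p ℤR.∣ (+ 0 ℤR.- + 1) → ℤR.nat p ℤR.∣ (+ 1)
      ≡mod-neg = ∣-neg ℤ-ring

    -- (X - 1) h = b forces the coefficients of h to be constant, hence zero.
    constant-multiple : ∀ b h → constantₚ ℤ-ring b E.≈ T E.* h → b F.≈ F.0#
    constant-multiple b h e = F.trans (F.sym (F.+-identityˡ b)) (F.trans (F.+-congʳ {b} (F.sym (h≈0 0))) h₀+b≈0)
      where
      h+b≈Xh : h E.+ constantₚ ℤ-ring b E.≈ X ℤ-ring E.* h
      h+b≈Xh = z≈[x-1]y⇒y+z≈xy E (X ℤ-ring) h (constantₚ ℤ-ring b) e
      h₀+b≈0 : coefficient h 0 F.+ b F.≈ F.0#
      h₀+b≈0 = F.trans (coefficient-≡mod h+b≈Xh 0) (≈⇒≡mod ℤ-ring _ (PP.coefficient-X*-zero h))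
      hᵢ≈hᵢ₊₁ : ∀ i → coefficient h i F.≈ coefficient h (suc i)
      hᵢ≈hᵢ₊₁ i = F.trans (F.sym (≈⇒≡mod ℤ-ring _ (PP.coefficient-X*-suc h i)))
        (F.trans (F.sym (coefficient-≡mod h+b≈Xh (suc i))) (F.+-identityʳ _))
      hᵢ≈hₖ₊ᵢ : ∀ k i → coefficient h i F.≈ coefficient h (k ℕ.+ i)
      hᵢ≈hₖ₊ᵢ zero    i = F.refl
      hᵢ≈hₖ₊ᵢ (suc k) i = F.trans (hᵢ≈hₖ₊ᵢ k i) (hᵢ≈hᵢ₊₁ (k ℕ.+ i))
      h≈0 : ∀ i → coefficient h i F.≈ F.0#
      h≈0 i = F.trans (hᵢ≈hₖ₊ᵢ (bound h) i) (≈⇒≡mod ℤ-ring _ (vanishes h _ (ℕₚ.m≤m+n (bound h) i)))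

    independent-mod-T^ : ∀ N b d → partial E (constantₚ ℤ-ring ∘ b) T N E.≈ d E.* T E.^ N →
      ∀ j → j < N → b j F.≈ F.0#
    independent-mod-T^ N = independent-mod-power E (constantₚ ℤ-ring) T T-cancel (λ b → b F.≈ F.0#)
      constant-multiple (λ b b≈0 → coefficients-≡mod λ { zero → b≈0 ; (suc i) → F.refl }) N

  module Cyclotomic (m : ℕ) where
    private
      q N : ℕ
      q = p ℕ.^ m
      N = q ℕ.* (p ∸ 1)

      A : CommutativeRing _ _
      A = ℤ[ζ] p (suc m)
      module A = RingNotation A
      module toA = HomomorphismProperties ℤ[X] A (quotient-homomorphism ℤ[X] (Φ p (suc m)))

      p≈0 : E.nat p E.≈ E.0#
      p≈0 = E.trans (E.sym (toE.nat-homo p)) (a≡0 ℤ[X] (P.nat p))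

      Y : P.Carrier
      Y = X ℤ-ring P.^ q

    Φ≡Σ : Φ p (suc m) E.≈ Σ< E (Y E.^_) p
    Φ≡Σ = E.trans (toE.sum-homo {p} (λ i → Y P.^ toℕ i)) (sum-cong-≋ {p} λ i → toE.^-homo Y (toℕ i))
      where open import Algebra.Properties.CommutativeMonoid.Sum E.+-commutativeMonoid using (sum-cong-≋)

    Φ≡T^N : Φ p (suc m) E.≈ T E.^ N
    Φ≡T^N = E.trans Φ≡Σ (E.trans
      (sum-cong-≋ {p} λ i → ^-congˡ (toℕ i) (toE.^-homo (X ℤ-ring) q))
      (geometric-sum-mod-p p-prime E p≈0 T T-cancel m (X ℤ-ring)
        (E.trans (x≈y+[x-y] E (X ℤ-ring) E.1#) (E.+-comm E.1# T))))
      where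
      open import Algebra.Properties.CommutativeMonoid.Sum E.+-commutativeMonoid using (sum-cong-≋)
      open import Algebra.Properties.Semiring.Exp E.semiring using (^-congˡ)

    -- At X = 0 only the summand with exponent 0 survives, as q > 0. This makes Φ cancellable modulo
    -- p.
    Φ₀≡1 : coefficient (Φ p (suc m)) 0 ≡ + 1
    Φ₀≡1 = go p (ℕ.≢-nonZero⁻¹ p)
      where
      module H = HomomorphismProperties ℤ[X] ℤ-ring PP.constant-coefficient-homomorphism
      open PartialSums ℤ-ring
      Y₀≡0 : coefficient Y 0 ≡ + 0
      Y₀≡0 = ≡.trans (H.^-homo (X ℤ-ring) q) (zero^ q (ℕ.≢-nonZero⁻¹ q ⦃ ℕₚ.m^n≢0 p m ⦄))
        where
        zero^ : ∀ k → k ≢ 0 → (+ 0) ℤR.^ k ≡ + 0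
        zero^ zero    k≢0 = contradiction ≡.refl k≢0
        zero^ (suc k) _   = ≡.refl
      go : ∀ k → k ≢ 0 → coefficient (P.sum {k} (λ i → Y P.^ toℕ i)) 0 ≡ + 1
      go zero    k≢0 = contradiction ≡.refl k≢0
      go (suc k) _   = ≡.cong (λ x → + 1 ℤ.+ x) (≡.trans (H.sum-homo {k} (λ i → Y P.^ suc (toℕ i)))
        (≡.trans (sum-cong-≋ {k} λ i → ≡.trans (H.*-homo Y (Y P.^ toℕ i)) (≡.cong (ℤ._* coefficient (Y P.^ toℕ i) 0) Y₀≡0)) (sum-replicate-zero k)))
        where
        open import Algebra.Properties.CommutativeMonoid.Sum ℤR.+-commutativeMonoid using (sum-cong-≋; sum-replicate-zero)

    Φ-cancel : ∀ f → Φ p (suc m) E.* f E.≈ E.0# → f E.≈ E.0#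
    Φ-cancel = cancel (Φ p (suc m)) λ e → p∤1 (≡.subst (ℤR.nat p ℤR.∣_) Φ₀≡1 (≡0mod⇒∣ ℤ-ring _ e))

    ℤ[ζ]-torsion-free : ∀ x → A.nat p A.* x A.≈ A.0# → x A.≈ A.0#
    ℤ[ζ]-torsion-free = quotient-torsion-free ℤ[X] p (Φ p (suc m)) Φ-cancel ℤ[X]-torsion-free

    private
      Φ≡T^N′ : Φ p (suc m) E.≈ T P.^ N
      Φ≡T^N′ = E.trans Φ≡T^N (E.sym (toE.^-homo T N))

    p∣[ζ-1]^N : A.nat p A.∣ (T A.^ N)
    p∣[ζ-1]^N = ∣-respʳ A (toA.^-homo T N) (nat∣-quotient ℤ[X] p Φ≡T^N′)

    ℤ[ζ]-independent : ∀ (b : ℕ → ℤ) → A.nat p A.∣ partial A (constantₚ ℤ-ring ∘ b) T N →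
      ∀ j → j < N → ℤR.nat p ℤR.∣ b j
    ℤ[ζ]-independent b p∣partial j j<N = ≡0mod⇒∣ ℤ-ring _
      (quotient-independent ℤ[X] p (constantₚ ℤ-ring) T N Φ≡T^N′ (λ b → b F.≈ F.0#) (independent-mod-T^ N) b p∣partial j j<N)

    ℤ[ζ]-generated : ∀ a → ∃₂ λ (f : ℕ → ℤ) k → a A.≈ partial A (constantₚ ℤ-ring ∘ f) (X ℤ-ring) k
    ℤ[ζ]-generated a = coefficient a , bound a , A.trans
      (≈⇒≡mod ℤ[X] _ (PP.polynomial-expansion a (bound a) (vanishes a)))
      (partial-homo ℤ[X] A (quotient-homomorphism ℤ[X] (Φ p (suc m))) (constantₚ ℤ-ring ∘ coefficient a) (X ℤ-ring) (bound a))

    -- Otherwise 1 would be a multiple of `T ^ N` in 𝔽_p[X] with N > 0, against `constant-multiple`.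
    -- It is used to rule out that ζ has order less than p^(m+1).
    p∤1-ℤ[ζ] : A.nat p A.∤ A.1#
    p∤1-ℤ[ζ] p∣1 = let d , e = nat∣-quotient⇒multiple ℤ[X] p Φ≡T^N′ p∣1 in
      go N (ℕ.≢-nonZero⁻¹ N ⦃ ℕₚ.m*n≢0 q (p ∸ 1) ⦄) d e
      where
      instance
        _ = ℕₚ.m^n≢0 p m
        _ = ℕ.>-nonZero (ℕₚ.m<n⇒0<n∸m (ℕ.nonTrivial⇒n>1 p))
      open import Algebra.Properties.CommutativeSemigroup E.*-commutativeSemigroup using (x∙yz≈y∙xz)
      go : ∀ N → N ≢ 0 → ∀ d → ¬ E.1# E.≈ d E.* T P.^ N
      go zero    N≢0 d e = contradiction ≡.refl N≢0
      go (suc N) N≢0 d e = p∤1 (≡0mod⇒∣ ℤ-ring _ (constant-multiple (+ 1) (d E.* T P.^ N)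
        (E.trans e (x∙yz≈y∙xz d T (T P.^ N)))))

    Σ[X^q]^i≡0 : Σ< A ((X ℤ-ring A.^ q) A.^_) p A.≈ A.0#
    Σ[X^q]^i≡0 = A.trans (Σ<-power-homo ℤ[X] A (quotient-homomorphism ℤ[X] (Φ p (suc m))) (X ℤ-ring) q p)
      (a≡0 ℤ[X] (Φ p (suc m)))

-- Roots of unity and the characters they define.

prime∤⇒coprime : ∀ {p k} → Prime p → ¬ p ℕ∣.∣ k → Coprime p k
prime∤⇒coprime p-prime p∤k (d∣p , d∣k) with prime⇒irreducible p-prime d∣p
... | inj₁ d≡1 = d≡1
... | inj₂ ≡.refl = contradiction d∣k p∤k

≡mod⇒signed-∣ : ∀ {k x y} → CongruentMod ℤ-ring k x y → k ℤ∣.∣ (x ℤ.- y)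
≡mod⇒signed-∣ (congruent (q ℤR., e)) = ℤ∣.divides q (≡.sym e)

module _ {c ℓ : Level} (O : CommutativeRing c ℓ) where
  open RingNotation O

  module RootOfUnity (ζ : Carrier) (M : ℕ) (ζ^M≈1 : ζ ^ M ≈ 1#) where
    open import Algebra.Properties.Semiring.Exp semiring using (^-congˡ; ^-congʳ; ^-assocʳ; ^-homo-*)
    open import Relation.Binary.Reasoning.Setoid setoid

    ^≈1-multiple : ∀ {x} m k → x ^ m ≈ 1# → x ^ (k ℕ.* m) ≈ 1#
    ^≈1-multiple {x} m k e = trans (^-congʳ x (ℕₚ.*-comm k m))
      (trans (sym (^-assocʳ x m k)) (trans (^-congˡ k e) (1^n≈1 O k)))

    private
      ^-cong-≥ : ∀ r s → s ≤ r → + M ℤ∣.∣ (+ r ℤ.- + s) → ζ ^ r ≈ ζ ^ s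
      ^-cong-≥ r s s≤r M∣ with ≡.subst (M ℕ∣.∣_) (≡.cong ∣_∣ (≡.trans (ℤₚ.m-n≡m⊖n r s) (ℤₚ.⊖-≥ s≤r))) (ℤ∣.∣⇒∣ᵤ M∣)
      ... | ℕ∣.divides k r∸s≡kM = begin
        ζ ^ r                       ≈⟨ ^-congʳ ζ (≡.trans (≡.sym (ℕₚ.m∸n+n≡m s≤r)) (≡.cong (ℕ._+ s) r∸s≡kM)) ⟩
        ζ ^ (k ℕ.* M ℕ.+ s)         ≈⟨ ^-homo-* ζ (k ℕ.* M) s ⟩
        ζ ^ (k ℕ.* M) * ζ ^ s       ≈⟨ *-congʳ (^≈1-multiple M k ζ^M≈1) ⟩
        1# * ζ ^ s                  ≈⟨ *-identityˡ _ ⟩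
        ζ ^ s                       ∎

    ^-cong-mod : ∀ r s → CongruentMod ℤ-ring (+ M) (+ r) (+ s) → ζ ^ r ≈ ζ ^ s
    ^-cong-mod r s e with ℕₚ.≤-total s r
    ... | inj₁ s≤r = ^-cong-≥ r s s≤r (≡mod⇒signed-∣ e)
    ... | inj₂ r≤s = sym (^-cong-≥ s r r≤s (≡mod⇒signed-∣ (CommutativeRing.sym (Quotient ℤ-ring (+ M)) e)))

module _ {c ℓ : Level} (O : CommutativeRing c ℓ) where
  open RingNotation O

  module PrimitiveRoot {p : ℕ} (p-prime : Prime p) (ζ : Carrier) (m : ℕ)
    (ζ^≈1 : ζ ^ (p ℕ.^ suc m) ≈ 1#) (ζ^≉1 : ¬ ζ ^ (p ℕ.^ m) ≈ 1#) where
    open import Algebra.Properties.Semiring.Exp semiring using (^-congˡ; ^-congʳ; ^-assocʳ; ^-homo-*)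
    open import Relation.Binary.Reasoning.Setoid setoid
    open RootOfUnity O ζ (p ℕ.^ suc m) ζ^≈1

    private
      W : Carrier
      W = ζ ^ (p ℕ.^ m)

      W^p≈1 : W ^ p ≈ 1#
      W^p≈1 = trans (^-assocʳ ζ (p ℕ.^ m) p) (trans (^-congʳ ζ (ℕₚ.*-comm (p ℕ.^ m) p)) ζ^≈1)

      bézout : ∀ a b x y → 1 ℕ.+ y ℕ.* b ≡ x ℕ.* a → W ^ a ≈ 1# → W ^ b ≈ 1# → W ≈ 1#
      bézout a b x y e W^a≈1 W^b≈1 = begin
        W                        ≈⟨ *-identityʳ W ⟨
        W * 1#                   ≈⟨ *-congˡ (^≈1-multiple b y W^b≈1) ⟨
        W ^ (1 ℕ.+ y ℕ.* b)      ≈⟨ ^-congʳ W e ⟩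
        W ^ (x ℕ.* a)            ≈⟨ ^≈1-multiple a x W^a≈1 ⟩
        1#                       ∎

      -- If p did not divide c, a Bézout relation between p and c would turn the two trivial powers
      -- of `W` into `W ≈ 1#`.
      W^c≈1⇒p∣c : ∀ c → W ^ c ≈ 1# → p ℕ∣.∣ c
      W^c≈1⇒p∣c c W^c≈1 with p ℕ∣.∣? c
      ... | yes p∣c = p∣c
      ... | no  p∤c with coprime-Bézout (prime∤⇒coprime p-prime p∤c)
      ...   | Bézout.+- x y e = contradiction (bézout p c x y e W^p≈1 W^c≈1) ζ^≉1
      ...   | Bézout.-+ x y e = contradiction (bézout c p y x e W^c≈1 W^p≈1) ζ^≉1

    -- Induction on a for p^a dividing k. If k = c p^a with a ≤ m, raising `ζ ^ k ≈ 1#` to the power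
    -- p^(m-a) gives `W ^ c ≈ 1#`, so p divides c.
    order∣ : ∀ k → ζ ^ k ≈ 1# → p ℕ.^ suc m ℕ∣.∣ k
    order∣ k ζ^k≈1 = go (suc m) ℕₚ.≤-refl
      where
      go : ∀ a → a ≤ suc m → p ℕ.^ a ℕ∣.∣ k
      go zero    _         = ℕ∣.1∣ k
      go (suc a) (s≤s a≤m) with go a (ℕₚ.m≤n⇒m≤1+n a≤m)
      ... | ℕ∣.divides c k≡c*p^a with W^c≈1⇒p∣c c (begin
        W ^ c                                ≈⟨ ^-assocʳ ζ (p ℕ.^ m) c ⟩
        ζ ^ (p ℕ.^ m ℕ.* c)                  ≈⟨ ^-congʳ ζ exponent ⟩
        ζ ^ (p ℕ.^ (m ∸ a) ℕ.* k)            ≈⟨ ^≈1-multiple k (p ℕ.^ (m ∸ a)) ζ^k≈1 ⟩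
        1#                                   ∎)
        where
        exponent : p ℕ.^ m ℕ.* c ≡ p ℕ.^ (m ∸ a) ℕ.* k
        exponent = ≡.trans (≡.cong (λ e → p ℕ.^ e ℕ.* c) (≡.sym (ℕₚ.m∸n+n≡m a≤m)))
          (≡.trans (≡.cong (ℕ._* c) (ℕₚ.^-distribˡ-+-* p (m ∸ a) a))
          (≡.trans (ℕₚ.*-assoc (p ℕ.^ (m ∸ a)) (p ℕ.^ a) c)
          (≡.cong (p ℕ.^ (m ∸ a) ℕ.*_) (≡.trans (ℕₚ.*-comm (p ℕ.^ a) c) (≡.sym k≡c*p^a)))))
      ...   | ℕ∣.divides d c≡d*p = ℕ∣.divides d (≡.trans k≡c*p^a
                (≡.trans (≡.cong (ℕ._* p ℕ.^ a) c≡d*p) (ℕₚ.*-assoc d p (p ℕ.^ a))))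

    private
      instance
        p^n≢0 : ℕ.NonZero (p ℕ.^ suc m)
        p^n≢0 = ℕₚ.m^n≢0 p (suc m) ⦃ prime⇒nonZero p-prime ⦄

      n : ℕ
      n = suc m
      Z/p^n : CommutativeRing _ _
      Z/p^n = Quotient ℤ-ring (+ (p ℕ.^ n))
      module Z/p^n = CommutativeRing Z/p^n

      p^n≡+ : ∀ k → ℤR.nat p ℤR.^ k ≡ + (p ℕ.^ k)
      p^n≡+ zero    = ≡.refl
      p^n≡+ (suc k) = ≡.trans (≡.cong₂ ℤ._*_ (nat≡+ p) (p^n≡+ k)) (≡.sym (ℤₚ.pos-* p (p ℕ.^ k)))

    -- The residue of a p-adic integer modulo p^n as a natural number. The character sends γ₂^x to
    -- ζ^x, which depends on this residue only.
    exponent : CommutativeRing.Carrier ℤ⟨ p ⟩ → ℕ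
    exponent x = Compatible.approx x n %ℕ (p ℕ.^ n)

    exponent≡ : ∀ x → Z/p^n._≈_ (+ exponent x) (Compatible.approx x n)
    exponent≡ x = Z/p^n.sym (congruent (xₙ /ℕ (p ℕ.^ n) ℤR., ≡.sym
      (x≈y+z⇒x-y≈z ℤ-ring (a≡a%ℕn+[a/ℕn]*n xₙ (p ℕ.^ n)))))
      where
      xₙ : ℤ
      xₙ = Compatible.approx x n

    ζ^exponent-γ₂≈ζ : ζ ^ exponent (γ₂ p) ≈ ζ
    ζ^exponent-γ₂≈ζ = trans (^-cong-mod (exponent (γ₂ p)) 1 (exponent≡ (γ₂ p))) (*-identityʳ ζ)

    abstract
      character : CharacterOfOrder (p ℕ.^ n) Γ⟨ p ⟩ O
      character = record
        { ψ = λ x → ζ ^ exponent x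
        ; isHomomorphism = record
          { isMagmaHomomorphism = record
            { isRelHomomorphism = record
              { cong = λ {x} {y} x≈y → ^-cong-mod (exponent x) (exponent y)
                  (Z/p^n.trans (exponent≡ x) (Z/p^n.trans
                    (≡.subst (λ M → CongruentMod ℤ-ring M (Compatible.approx x n) (Compatible.approx y n)) (p^n≡+ n)
                      (CompatibleEq.at-level x≈y n))
                    (Z/p^n.sym (exponent≡ y))))
              }
            ; homo = λ x y → trans
                (^-cong-mod (exponent (x +ᵖ y)) (exponent x ℕ.+ exponent y)
                  (Z/p^n.trans (exponent≡ (x +ᵖ y)) (Z/p^n.+-cong (Z/p^n.sym (exponent≡ x)) (Z/p^n.sym (exponent≡ y)))))
                (^-homo-* ζ (exponent x) (exponent y))
            }
          ; ε-homo = ^-cong-mod (exponent 0ᵖ) 0 (exponent≡ 0ᵖ)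
          }
        ; order-divides = λ x → trans (^-assocʳ ζ (exponent x) (p ℕ.^ n)) (^≈1-multiple (p ℕ.^ n) (exponent x) ζ^≈1)
        -- The value at `γ₂` is ζ, which has exact order p^n.
        ; order-least = λ k ψ^k≈1 → order∣ k (trans (^-congˡ k (sym ζ^exponent-γ₂≈ζ)) (ψ^k≈1 (γ₂ p)))
        }
        where
        open CommutativeRing ℤ⟨ p ⟩ using () renaming (_+_ to _+ᵖ_; 0# to 0ᵖ)

      character-γ₂ : CharacterOfOrder.ψ character (γ₂ p) ≈ ζ
      character-γ₂ = ζ^exponent-γ₂≈ζ

-- Assembly for the characters sending γ₂ to the class of X.

module _ {c ℓ : Level} (R : CommutativeRing c ℓ) where
  open RingNotation R
  private module R⟦T⟧ = RingNotation (R ⟦T⟧)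
  open import Algebra.Properties.Semiring.Exp semiring using (^-congˡ)

  -- Connects p ∤ g(T₁,0) in the power series ring with the coefficientwise form that the descent
  -- expects.
  nat∣series : ∀ m {f} → (∀ i → nat m ∣ f i) → R⟦T⟧.nat m R⟦T⟧.∣ f
  nat∣series m {f} m∣f = q R⟦T⟧., R⟦T⟧.trans (R⟦T⟧.*-comm q (R⟦T⟧.nat m)) (R⟦T⟧.trans (nat-* (R ⟦T⟧) m q)
    (coefficientwise λ i → trans (reflexive (·-coefficient m i)) (trans (sym (nat-* R m (q i)))
      (trans (*-comm (nat m) (q i)) (qm≈f i)))))
    where
    q : Series R
    q i = let (q , _) = m∣f i in q
    qm≈f : ∀ i → q i * nat m ≈ f i
    qm≈f i = let (_ , e) = m∣f i in e
    ·-coefficient : ∀ m i → (m R⟦T⟧.· q) i ≡ m · q i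
    ·-coefficient zero    i = ≡.refl
    ·-coefficient (suc m) i = ≡.cong (λ x → q i + x) (·-coefficient m i)

  Σ<-power≈0⇒power≈1 : ∀ y k → Σ< R (y ^_) k ≈ 0# → y ^ k ≈ 1#
  Σ<-power≈0⇒power≈1 y k Σ≈0 = trans
    (sym (geometric-sum R (y - 1#) y k (trans (x≈y+[x-y] R y 1#) (+-comm _ _))))
    (trans (+-congʳ (trans (*-congʳ Σ≈0) (zeroˡ _))) (+-identityˡ 1#))

  Σ<-power-of-one : ∀ y k → y ≈ 1# → Σ< R (y ^_) k ≈ nat k
  Σ<-power-of-one y zero    y≈1 = refl
  Σ<-power-of-one y (suc k) y≈1 = trans (Σ<-suc R (y ^_) k) (trans (+-comm _ _)
    (+-cong (trans (^-congˡ k y≈1) (1^n≈1 R k)) (Σ<-power-of-one y k y≈1)))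

record CyclotomicFacts (p n N : ℕ) : Set where
  private
    module A = RingNotation (ℤ[ζ] p n)
  field
    torsion-free : ∀ x → A.nat p A.* x A.≈ A.0# → x A.≈ A.0#
    divides      : A.nat p A.∣ ((X ℤ-ring A.- A.1#) A.^ N)
    independent  : ∀ (b : ℕ → ℤ) → A.nat p A.∣ partial (ℤ[ζ] p n) (constantₚ ℤ-ring ∘ b) (X ℤ-ring A.- A.1#) N →
                   ∀ j → j < N → ℤR.nat p ℤR.∣ b j
    generated    : ∀ a → ∃₂ λ (f : ℕ → ℤ) k → a A.≈ partial (ℤ[ζ] p n) (constantₚ ℤ-ring ∘ f) (X ℤ-ring) k

module _ {p : ℕ} (p-prime : Prime p) (χ : FiniteOrderCharacter p) where
  open FiniteOrderCharacter χ

  module Values (N : ℕ)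
    (facts : CyclotomicFacts p n N)
    (ψγ₂≈X : CommutativeRing._≈_ 𝒪 (ψ (γ₂ p)) (diagonal (ℤ[ζ] p n) p (X ℤ-ring))) where
    open CyclotomicFacts facts
    private
      module CS = CompletedSpecialisation p-prime ℤ-ring (ℤ[ζ] p n) (ℤ-torsion-free p-prime) torsion-free
        (ℤ→ℤ[ζ]-isRingHomomorphism p n) n N (X ℤ-ring)
        divides independent generated (ψ (γ₂ p)) ψγ₂≈X (order-divides (γ₂ p))

    specialisation : Specialisation ℤ⟨ p ⟩ 𝒪 (RingNotation.nat ℤ⟨ p ⟩ p) (RingNotation.nat 𝒪 p) N
    specialisation = CS.specialisation

    ev≈specialise : ∀ h i → CommutativeRing._≈_ 𝒪 (Specialisation.ev specialisation (h i)) (specialise p-prime χ h i)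
    ev≈specialise h i = CS.EV≈evaluate (h i) (λ j → ι p n (h i j)) λ j → levelwise λ k →
      CommutativeRing.refl (R/p^ (ℤ[ζ] p n) p k) {constantₚ ℤ-ring (Compatible.approx (h i j) k)}

module _ {p : ℕ} (p-prime : Prime p) where
  private
    instance
      _ = prime⇒nonZero p-prime
      _ = prime⇒nonTrivial p-prime
    B : CommutativeRing _ _
    B = ℤ⟨ p ⟩
    module B = RingNotation B
    module BC = CompletionProperties ℤ-ring p
    open Compatible

    p-prime-in-ℤ⟨p⟩ : ∀ x y → B.nat p B.∣ x B.* y → B.nat p B.∣ x ⊎ B.nat p B.∣ y
    p-prime-in-ℤ⟨p⟩ x y p∣xy = Sum.map (BC.p∣level₁⇒p∣ (ℤ-torsion-free p-prime)) (BC.p∣level₁⇒p∣ (ℤ-torsion-free p-prime))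
      (ℤ-euclid p-prime (approx x 1) (approx y 1) (BC.p∣⇒p∣level₁ p∣xy))

    p∣? : ∀ x → Dec (B.nat p B.∣ x)
    p∣? x = map′ (BC.p∣level₁⇒p∣ (ℤ-torsion-free p-prime)) BC.p∣⇒p∣level₁ (nat∣? p (approx x 1))

    N : ℕ → ℕ
    N m = p ℕ.^ m ℕ.* (p ∸ 1)

    m<p^m : ∀ m → m < p ℕ.^ m
    m<p^m zero    = s≤s z≤n
    m<p^m (suc m) = ℕₚ.≤-<-trans (m<p^m m) (≡.subst (p ℕ.^ m <_) (ℕₚ.*-comm (p ℕ.^ m) p)
      (ℕₚ.m<m*n (p ℕ.^ m) p ⦃ ℕₚ.m^n≢0 p m ⦄ (ℕ.nonTrivial⇒n>1 p)))

    -- Makes the truncation orders unbounded: level `m` itself already controls the T₂-degree `m`.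
    m<Nm : ∀ m → m < N m
    m<Nm m = ℕₚ.<-≤-trans (m<p^m m) (ℕₚ.m≤m*n (p ℕ.^ m) (p ∸ 1)
      ⦃ ℕ.>-nonZero (ℕₚ.m<n⇒0<n∸m (ℕ.nonTrivial⇒n>1 p)) ⦄)

  module _ (m : ℕ) where
    open Cyclotomic p-prime m
    private
      A O : CommutativeRing _ _
      A = ℤ[ζ] p (suc m)
      O = ℤ⟨ p ⟩[ζ suc m ]
      module O = RingNotation O
      module OC = CompletionProperties A p

      ξ : O.Carrier
      ξ = diagonal A p (X ℤ-ring)

      Σ≈0 : Σ< O ((ξ O.^ (p ℕ.^ m)) O.^_) p O.≈ O.0#
      Σ≈0 = O.trans (Σ<-power-homo A O OC.diagonal-homomorphism (X ℤ-ring) (p ℕ.^ m) p)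
        (HomomorphismProperties.⟦⟧-cong A O OC.diagonal-homomorphism Σ[X^q]^i≡0)

      ξ^≈1 : ξ O.^ (p ℕ.^ suc m) O.≈ O.1#
      ξ^≈1 = O.trans (^-congʳ ξ (ℕₚ.*-comm p (p ℕ.^ m))) (O.trans (O.sym (^-assocʳ ξ (p ℕ.^ m) p))
        (Σ<-power≈0⇒power≈1 O (ξ O.^ (p ℕ.^ m)) p Σ≈0))
        where open import Algebra.Properties.Semiring.Exp O.semiring using (^-congʳ; ^-assocʳ)

      -- Otherwise the vanishing sum of p powers would equal p. Torsion-freeness would then give 1 =
      -- 0 in the completion, and at level 1 p would divide 1 in ℤ[ζ].
      ξ^≉1 : ¬ ξ O.^ (p ℕ.^ m) O.≈ O.1#
      ξ^≉1 e = p∤1-ℤ[ζ] (OC.p∣⇒p∣level₁ (O.0# O., O.trans (O.zeroˡ (O.nat p)) (O.sym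
        (OC.completion-torsion-free ℤ[ζ]-torsion-free O.1# (O.trans (O.*-identityʳ (O.nat p))
          (O.trans (O.sym (Σ<-power-of-one O (ξ O.^ (p ℕ.^ m)) p e)) Σ≈0))))))

      open PrimitiveRoot O p-prime ξ m ξ^≈1 ξ^≉1

    χ : FiniteOrderCharacter p
    χ = record { n = suc m ; character = character }

    cyclotomicFacts : CyclotomicFacts p (suc m) (N m)
    cyclotomicFacts = record
      { torsion-free = ℤ[ζ]-torsion-free
      ; divides      = p∣[ζ-1]^N
      ; independent  = ℤ[ζ]-independent
      ; generated    = ℤ[ζ]-generated
      }

    module V = Values p-prime χ (N m) cyclotomicFacts character-γ₂

  module _ (g : CommutativeRing.Carrier ℤ⟨ p ⟩⟦T₁,T₂⟧)
    (p∤g[T₁,0] : RingNotation._∤_ (ℤ⟨ p ⟩ ⟦T⟧) (RingNotation.nat (ℤ⟨ p ⟩ ⟦T⟧) p) (g [T₁,0])) where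
    open Descent ℤ⟨ p ⟩ (B.nat p) p-prime-in-ℤ⟨p⟩ p∣? (λ m → FiniteOrderCharacter.𝒪 (χ m))
      (λ m → RingNotation.nat (FiniteOrderCharacter.𝒪 (χ m)) p) N V.specialisation (λ j → j , m<Nm j)
      g (λ p∣g → p∤g[T₁,0] (nat∣series ℤ⟨ p ⟩ p p∣g))

    divides-specialisations : ∀ L →
      (∀ m → RingNotation._∣_ (FiniteOrderCharacter.𝒪 (χ m) ⟦T⟧) (specialise p-prime (χ m) g) (specialise p-prime (χ m) L)) →
      DividesSpecialisations L
    divides-specialisations L divides = record
      { quotient = λ m → let (q RingNotation., _) = divides m in q
      ; equality = λ m i →
          let module O = RingNotation (FiniteOrderCharacter.𝒪 (χ m))
              module O⟦T⟧ = RingNotation (FiniteOrderCharacter.𝒪 (χ m) ⟦T⟧)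
              (q RingNotation., e) = divides m
          in O.trans (SeriesEq.at (O⟦T⟧.*-congˡ {q} (coefficientwise (V.ev≈specialise m g))) i)
               (O.trans (SeriesEq.at e i) (O.sym (V.ev≈specialise m L i)))
      }

    divides-of-divides-specialisations : ∀ L →
      (∀ m → RingNotation._∣_ (FiniteOrderCharacter.𝒪 (χ m) ⟦T⟧) (specialise p-prime (χ m) g) (specialise p-prime (χ m) L)) →
      RingNotation._∣_ ℤ⟨ p ⟩⟦T₁,T₂⟧ g L
    divides-of-divides-specialisations L divides =
      divides-of-specialisations BC.complete BC.separated L (divides-specialisations L divides)

∣-reflexive : {c ℓ : Level} (R : CommutativeRing c ℓ) (let open RingNotation R) → ∀ x → x ∣ x
∣-reflexive R x = 1# , *-identityˡ x
  where open RingNotation R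

theorem4p1 : (p : ℕ) (p-prime : Prime p) → p ≢ 2 →
    (g L : CommutativeRing.Carrier ℤ⟨ p ⟩⟦T₁,T₂⟧) →
    let module Λ = RingNotation ℤ⟨ p ⟩⟦T₁,T₂⟧
        module Λ₁ = RingNotation (ℤ⟨ p ⟩ ⟦T⟧) in
    Λ₁.nat p Λ₁.∤ (g [T₁,0]) →
    ((χ : FiniteOrderCharacter p) →
      let module 𝒪₁ = RingNotation (FiniteOrderCharacter.𝒪 χ ⟦T⟧) in
      𝒪₁.⟨ specialise p-prime χ L ⟩ ⊆ 𝒪₁.⟨ specialise p-prime χ g ⟩) →
    Λ.⟨ L ⟩ ⊆ Λ.⟨ g ⟩
-- Applying each inclusion to the generator `specialise L` turns it into a divisibility by
-- `specialise g`. The result g ∣ L then passes to all multiples of L.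
theorem4p1 p p-prime _ g L p∤g[T₁,0] specialisations = ∣-transitive ℤ⟨ p ⟩⟦T₁,T₂⟧
  (divides-of-divides-specialisations p-prime g p∤g[T₁,0] L λ m →
    specialisations (χ p-prime m) (∣-reflexive (FiniteOrderCharacter.𝒪 (χ p-prime m) ⟦T⟧)
      (specialise p-prime (χ p-prime m) L)))
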